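{- Given an $n$-vertex undirected graph $G=(V,E)$, one can count the number of perfect matchings in $G$ in $\mathcal{O}^\star(2^{n/2})$ time and polynomial space.
   Context: Graphs are finite. The notation $\mathcal{O}^\star(\cdot)$ suppresses factors polynomial in the input size. -}

module Defs where

open import Data.Bool as Bool using (Bool)
open import Data.Fin using (Fin; zero)
open import Data.Fin.Subset using (Subset; _∈_)
open import Data.List using (List; []; _∷_; length; map; foldr)
import Data.List.Membership.Propositional as List
open import Data.List.Relation.Unary.Unique.Propositional using (Unique)
open import Data.Nat using (ℕ; zero; suc; _+_; _*_; _∸_; _/_; _⊔_)
open import Data.Nat.ListAction using (sum)
open import Data.Nat.Logarithm using (⌊log₂_⌋)
open import Data.Product using (∃!; ∃-syntax; _×_)
open import Data.Vec as Vec using (Vec; []; _∷_; lookup; updateAt)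
open import Function using (_⇔_)
open import Relation.Binary using (Rel; Symmetric; Irreflexive; _⇒_)
open import Relation.Binary.PropositionalEquality using (_≡_; _≢_)
open import Level using (0ℓ)

Matrix : ℕ → Set
Matrix n = Vec (Subset n) n

Adj : ∀ {n} → Matrix n → Rel (Fin n) 0ℓ
Adj A u v = v ∈ lookup A u

-- Finite simple graphs on the vertex set Fin n; the edge set is given by its
-- adjacency matrix.
record Graph (n : ℕ) : Set where
  field
    edges     : Matrix n
    symmetric : Symmetric (Adj edges)
    loopless  : Irreflexive _≡_ (Adj edges)

open Graph public

-- A set M of edges, encoded like the edge set of the graph by a symmetric
-- matrix, so that distinct sets of edges are distinct matrices.
record IsPerfectMatching {n : ℕ} (G : Graph n) (M : Matrix n) : Set where
  field
    symmetricᴹ : Symmetric (Adj M)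
    subset     : Adj M ⇒ Adj (edges G)
    perfect    : ∀ u → ∃! _≡_ (Adj M u)

-- Exactly m elements of A satisfy P.
HasCardinality : {A : Set} → (A → Set) → ℕ → Set
HasCardinality P m =
  ∃[ xs ] Unique xs × (∀ x → (x List.∈ xs) ⇔ P x) × length xs ≡ m

-- The model of computation is a random access machine with logarithmic cost and
-- structured control flow. Its memory consists of k arrays of natural numbers.
-- All cells of an array are accessible; those beyond the end of the list have
-- not been allocated yet and hold 0.
Memory : ℕ → Set
Memory k = Vec (List ℕ) k

read : List ℕ → ℕ → ℕ
read []       _       = 0
read (x ∷ xs) zero    = x
read (x ∷ xs) (suc i) = read xs i

write : List ℕ → ℕ → ℕ → List ℕ
write []       zero    v = v ∷ []
write []       (suc i) v = 0 ∷ write [] i v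
write (x ∷ xs) zero    v = v ∷ xs
write (x ∷ xs) (suc i) v = x ∷ write xs i v

infixl 6 _⊕_ _⊖_
infixl 7 _⊗_ _⊘_
infix  8 _[_]

-- The operations are +, truncated subtraction, * and floor division, with
-- division by zero giving 0.
data Exp (k : ℕ) : Set where
  lit             : ℕ → Exp k
  _[_]            : Fin k → Exp k → Exp k
  _⊕_ _⊖_ _⊗_ _⊘_ : Exp k → Exp k → Exp k

infix  4 _[_]:=_ if_then_else_ while_repeat_
infixr 3 _⨾_

data Program (k : ℕ) : Set where
  skip          : Program k
  _[_]:=_       : Fin k → Exp k → Exp k → Program k
  _⨾_           : Program k → Program k → Program k
  if_then_else_ : Exp k → Program k → Program k → Program k
  while_repeat_ : Exp k → Program k → Program k

quotient : ℕ → ℕ → ℕ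
quotient m zero    = 0
quotient m (suc n) = m / suc n

eval : ∀ {k} → Memory k → Exp k → ℕ
eval σ (lit c)   = c
eval σ (x [ e ]) = read (lookup σ x) (eval σ e)
eval σ (e ⊕ f)   = eval σ e + eval σ f
eval σ (e ⊖ f)   = eval σ e ∸ eval σ f
eval σ (e ⊗ f)   = eval σ e * eval σ f
eval σ (e ⊘ f)   = quotient (eval σ e) (eval σ f)

-- Length of the binary representation, with 0 written as a single digit.
bits : ℕ → ℕ
bits m = suc ⌊log₂ m ⌋

-- The logarithmic cost of evaluating e: the total number of bits of the values
-- of all subexpressions of e, addresses included.
cost : ∀ {k} → Memory k → Exp k → ℕ
cost σ (lit c)     = bits c
cost σ t@(x [ e ]) = cost σ e + bits (eval σ t)
cost σ t@(e ⊕ f)   = cost σ e + cost σ f + bits (eval σ t)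
cost σ t@(e ⊖ f)   = cost σ e + cost σ f + bits (eval σ t)
cost σ t@(e ⊗ f)   = cost σ e + cost σ f + bits (eval σ t)
cost σ t@(e ⊘ f)   = cost σ e + cost σ f + bits (eval σ t)

-- Writing to address a allocates all cells up to a, each of which occupies at
-- least one bit, so addresses need not be stored alongside the values.
size : ∀ {k} → Memory k → ℕ
size σ = Vec.sum (Vec.map (λ xs → sum (map bits xs)) σ)

-- ⟨ P , σ ⟩⇓ σ′ ⟨ t , s ⟩ : started in memory σ, the program P halts in memory
-- σ′ after time t, having used space at most s at every moment. The cost of
-- evaluating an expression also bounds the space its intermediate values
-- occupy, and is added to the size of the memory while it is evaluated.
data ⟨_,_⟩⇓_⟨_,_⟩ {k : ℕ} :
     Program k → Memory k → Memory k → ℕ → ℕ → Set where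

  skip : ∀ {σ} → ⟨ skip , σ ⟩⇓ σ ⟨ 1 , size σ ⟩

  assign : ∀ {σ x a e} →
    let σ′ = updateAt σ x (λ xs → write xs (eval σ a) (eval σ e))
        c  = cost σ a + cost σ e
    in ⟨ x [ a ]:= e , σ ⟩⇓ σ′ ⟨ suc c , (size σ + c) ⊔ size σ′ ⟩

  seq : ∀ {P Q σ σ′ σ″ t t′ s s′} →
    ⟨ P , σ ⟩⇓ σ′ ⟨ t , s ⟩ →
    ⟨ Q , σ′ ⟩⇓ σ″ ⟨ t′ , s′ ⟩ →
    ⟨ P ⨾ Q , σ ⟩⇓ σ″ ⟨ t + t′ , s ⊔ s′ ⟩

  if-true : ∀ {e P Q σ σ′ t s} → eval σ e ≢ 0 →
    ⟨ P , σ ⟩⇓ σ′ ⟨ t , s ⟩ →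
    ⟨ if e then P else Q , σ ⟩⇓ σ′
      ⟨ suc (cost σ e + t) , (size σ + cost σ e) ⊔ s ⟩

  if-false : ∀ {e P Q σ σ′ t s} → eval σ e ≡ 0 →
    ⟨ Q , σ ⟩⇓ σ′ ⟨ t , s ⟩ →
    ⟨ if e then P else Q , σ ⟩⇓ σ′
      ⟨ suc (cost σ e + t) , (size σ + cost σ e) ⊔ s ⟩

  while-true : ∀ {e P σ σ′ σ″ t t′ s s′} → eval σ e ≢ 0 →
    ⟨ P , σ ⟩⇓ σ′ ⟨ t , s ⟩ →
    ⟨ while e repeat P , σ′ ⟩⇓ σ″ ⟨ t′ , s′ ⟩ →
    ⟨ while e repeat P , σ ⟩⇓ σ″
      ⟨ suc (cost σ e + (t + t′)) , (size σ + cost σ e) ⊔ (s ⊔ s′) ⟩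

  while-false : ∀ {e P σ} → eval σ e ≡ 0 →
    ⟨ while e repeat P , σ ⟩⇓ σ ⟨ suc (cost σ e) , size σ + cost σ e ⟩

-- The first array holds n, the second the adjacency matrix row by row; the
-- remaining k arrays are empty.
input : ∀ {n} → Graph n → (k : ℕ) → Memory (2 + k)
input {n} G k = (n ∷ []) ∷ Vec.toList adjacency ∷ Vec.replicate k []
  where
  bit : Bool → ℕ
  bit b = Bool.if b then 1 else 0

  adjacency = Vec.map bit (Vec.concat (edges G))

output : ∀ {k} → Memory (2 + k) → ℕ
output σ = read (lookup σ zero) 0

-- Polynomials with natural coefficients, constant coefficient first.
Polynomial : Set
Polynomial = List ℕ

infix 8 _at_

_at_ : Polynomial → ℕ → ℕ
p at x = foldr (λ a r → a + x * r) 0 p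

-- The number of perfect matchings is the hafnian of the adjacency matrix B, which
-- we compute by the recursion of Björklund that treats the vertices in pairs.  For
-- a pair u, v let C i j = B u i * B v j + B u j * B v i count the detours from i to
-- j through u and v.  A perfect matching either contains uv, or replacing its edges
-- at u and v by one detour gives a matching of the other vertices, so that
--
--   haf B = B u v * haf B′ + (derivative of haf at B′ in the direction C),
--
-- where B′ is B without u and v.  This is the coefficient of X in
-- (1 + X * B u v) * haf (B′ + X * C) - haf B′.  Iterating this difference over all
-- n/2 pairs gives an alternating sum of 2^(n/2) products that is congruent to
-- X^(n/2) * haf B modulo X^(n/2 + 1).  If X is an integer above haf B, computing in
-- the integers modulo X^(n/2 + 1) suffices to recover haf B.

module Submission where

open import Defs
open import Algebra.Bundles using (CommutativeSemiring)
import Algebra.Solver.Ring.NaturalCoefficients.Default as SemiringSolver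
open import Algebra.Structures.Biased using (isCommutativeSemiringˡ)
open import Data.Bool as Bool using (Bool; true; false; T)
open import Data.Empty using (⊥; ⊥-elim)
open import Data.Fin as Fin using (Fin; zero; suc; toℕ)
import Data.Fin.Properties as Fin
open import Data.Fin.Subset using (Subset; _∈_)
open import Data.Fin.Subset.Properties using (_∈?_; ⊆-antisym)
open import Data.List as List using (List; []; _∷_; length; map; _++_; allFin)
open import Data.List.Membership.Propositional using () renaming (_∈_ to _∈ᴸ_; _∉_ to _∉ᴸ_)
open import Data.List.Membership.Propositional.Properties
  using (∈-++⁺ˡ; ∈-++⁺ʳ; ∈-++⁻; ∈-map⁺; ∈-map⁻; ∈-allFin)
open import Data.List.Properties using (length-++; length-map; length-tabulate; map-tabulate)
open import Data.List.Relation.Binary.Permutation.Propositional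
  using (_↭_; ↭-refl; ↭-sym; ↭-trans; prep; swap; ↭⇒↭ₛ)
open import Data.List.Relation.Binary.Permutation.Propositional.Properties using (∈-resp-↭; ↭-length)
open import Data.List.Relation.Binary.Permutation.Setoid.Properties using (Unique-resp-↭)
open import Data.List.Relation.Unary.All as All using (All; []; _∷_)
import Data.List.Relation.Unary.AllPairs as AllPairs
open import Data.List.Relation.Unary.Any using (here; there)
open import Data.List.Relation.Unary.Unique.Propositional using (Unique; []; _∷_)
import Data.List.Relation.Unary.Unique.Propositional.Properties as Unique
open import Data.Nat
  using (ℕ; zero; suc; _+_; _*_; _∸_; _^_; _/_; _%_; _≤_; _<_; _⊔_; _≤ᵇ_;
         z≤n; s≤s; NonZero; >-nonZero; >-nonZero⁻¹)
open import Data.Nat.DivMod hiding (_mod_)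
open import Data.Nat.Divisibility using (divides)
open import Data.Nat.ListAction using (sum)
open import Data.Nat.Logarithm using (⌊log₂⌋-mono-≤; ⌊log₂[2^n]⌋≡n)
open import Data.Nat.Solver using (module +-*-Solver)
open import Data.Product using (Σ-syntax; ∃-syntax; ∃!; _×_; _,_; proj₁; proj₂)
open import Data.Sum using (_⊎_; inj₁; inj₂; [_,_]′)
open import Data.Vec as Vec using (Vec; []; _∷_; lookup; tabulate; updateAt)
open import Data.Vec.Properties
  using (lookup∘tabulate; tabulate∘lookup; tabulate-cong; []=⇒lookup; lookup⇒[]=;
         lookup∘updateAt; lookup∘updateAt′; lookup-map; lookup-concat; length-toList)
open import Function using (_∘_; id; mk⇔)
open import Level using (0ℓ)
open import Relation.Binary using (Decidable; IsEquivalence)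
open import Relation.Binary.PropositionalEquality as ≡
  using (_≡_; _≢_; cong; cong₂; subst; module ≡-Reasoning)
open import Relation.Nullary using (¬_; Dec; yes; no; does; contradiction)
open import Relation.Nullary.Decidable using (_×-dec_; _⊎-dec_; ¬?; dec-true)

-- The hafnian and Björklund's recursion in commutative rings

-- The congruence does not pass through an induction over one fixed ring. The induction hypothesis
-- writes each of the two terms of the difference as X^k times a hafnian plus X * r, and the step
-- has to gain a factor X. For that the two remainders r must agree modulo X, which unrelated
-- witnesses do not give. The statement is therefore proved for all rings with a marked X at once:
-- the hypothesis is used over R[x] with x² = X x, for the single matrix B′ + x C, and the
-- evaluations x = X and x = 0 yield both terms, with remainders that differ by a multiple of X.
-- Integers modulo X^(n/2 + 1) in place of truncated polynomials let one memory cell hold a ring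
-- element. Cells have polynomially many bits, so time and space follow from counting primitive
-- steps. Space stays polynomial because the alternating sum is taken leaf by leaf: the binary
-- digits of a counter choose the branch at each pair, and only the n/2 + 1 matrices of one leaf are
-- stored.

module Hafnian (R : CommutativeSemiring 0ℓ 0ℓ) (A : Set) where

  open CommutativeSemiring R 
    using (_≈_; refl; sym; trans; setoid; +-cong; *-cong; +-congˡ; *-congˡ; +-identityˡ; zeroʳ)
    renaming (Carrier to C; _+_ to _⊞_; _*_ to _⊠_; 0# to 𝟎; 1# to 𝟏)
  open SemiringSolver R using (solve; _:+_; _:*_; _:=_)
  open import Relation.Binary.Reasoning.Setoid setoid

  -- The sum of f a r over all ways of removing an element a of the list, where
  -- r is the list that remains.
  Σsel : (A → List A → C) → List A → C
  Σsel f []      = 𝟎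
  Σsel f (w ∷ l) = f w l ⊞ Σsel (λ a r → f a (w ∷ r)) l

  Σsel-cong : ∀ {f g} → (∀ a r → f a r ≈ g a r) → ∀ l → Σsel f l ≈ Σsel g l
  Σsel-cong f≈g []      = refl
  Σsel-cong f≈g (w ∷ l) = +-cong (f≈g w l) (Σsel-cong (λ a r → f≈g a (w ∷ r)) l)

  Σsel-zero : ∀ l → Σsel (λ _ _ → 𝟎) l ≈ 𝟎
  Σsel-zero []      = refl
  Σsel-zero (w ∷ l) = trans (+-identityˡ _) (Σsel-zero l)

  Σsel-+ : ∀ {f g} l → Σsel (λ a r → f a r ⊞ g a r) l ≈ Σsel f l ⊞ Σsel g l
  Σsel-+ []      = sym (+-identityˡ _)
  Σsel-+ {f} {g} (w ∷ l) = trans (+-congˡ (Σsel-+ l))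
    (solve 4 (λ a b c d → (a :+ b) :+ (c :+ d) := (a :+ c) :+ (b :+ d)) refl _ _ _ _)

  Σsel-* : ∀ c {f} l → Σsel (λ a r → c ⊠ f a r) l ≈ c ⊠ Σsel f l
  Σsel-* c []      = sym (zeroʳ c)
  Σsel-* c (w ∷ l) = trans (+-congˡ (Σsel-* c l))
    (solve 3 (λ c a b → c :* a :+ c :* b := c :* (a :+ b)) refl c _ _)

  Σsel-swap : ∀ (f : A → A → List A → C) l →
    Σsel (λ a → Σsel (f a)) l ≈ Σsel (λ b → Σsel (λ a → f a b)) l
  Σsel-swap f []      = refl
  Σsel-swap f (w ∷ l) = begin
    Σsel (f w) l ⊞ Σsel (λ a r → f a w r ⊞ Σsel (λ b s → f a b (w ∷ s)) r) l
      ≈⟨ +-congˡ (Σsel-+ l) ⟩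
    Σsel (f w) l ⊞ (Σsel (λ a → f a w) l ⊞ Σsel (λ a → Σsel (λ b s → f a b (w ∷ s))) l)
      ≈⟨ +-congˡ (+-congˡ (Σsel-swap (λ a b s → f a b (w ∷ s)) l)) ⟩
    Σsel (f w) l ⊞ (Σsel (λ a → f a w) l ⊞ Σsel (λ b → Σsel (λ a s → f a b (w ∷ s))) l)
      ≈⟨ solve 3 (λ a b c → a :+ (b :+ c) := b :+ (a :+ c)) refl _ _ _ ⟩
    Σsel (λ a → f a w) l ⊞ (Σsel (f w) l ⊞ Σsel (λ b → Σsel (λ a s → f a b (w ∷ s))) l)
      ≈⟨ +-congˡ (Σsel-+ l) ⟨
    Σsel (λ a → f a w) l ⊞ Σsel (λ b r → f w b r ⊞ Σsel (λ a s → f a b (w ∷ s)) r) l ∎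

  -- The hafnian of B restricted to the list, or 0 if its length is not 2k.
  haf : (A → A → C) → ℕ → List A → C
  haf B zero    []      = 𝟏
  haf B zero    (_ ∷ _) = 𝟎
  haf B (suc k) []      = 𝟎
  haf B (suc k) (u ∷ l) = Σsel (λ v r → B u v ⊠ haf B k r) l

  -- The derivative of haf at B in the direction Δ.
  dhaf : (A → A → C) → (A → A → C) → ℕ → List A → C
  dhaf B Δ zero    l       = 𝟎
  dhaf B Δ (suc k) []      = 𝟎
  dhaf B Δ (suc k) (u ∷ l) = Σsel (λ v r → Δ u v ⊠ haf B k r ⊞ B u v ⊠ dhaf B Δ k r) l

  detour : (A → A → C) → A → A → A → A → C
  detour B u v i j = B u i ⊠ B v j ⊞ B u j ⊠ B v i

  -- In the sum on the right, the first vertex `w` of the list is the partner of `u`, the partner of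
  -- `v`, or joined to a third vertex `z`. The first two cases are the two summands of the detour
  -- `Δ w z`; the third is the induction hypothesis beside the edge from `w` to `z`.
  dhaf-detour : ∀ B u v k l →
    dhaf B (detour B u v) k l ≈ Σsel (λ a r → B u a ⊠ haf B k (v ∷ r)) l
  dhaf-detour B u v zero l =
    sym (trans (Σsel-cong (λ a r → zeroʳ (B u a)) l) (Σsel-zero l))
  dhaf-detour B u v (suc k) [] = refl
  dhaf-detour B u v (suc k) (w ∷ l) = begin
    Σsel (λ z r → (B u w ⊠ B v z ⊞ B u z ⊠ B v w) ⊠ haf B k r ⊞ B w z ⊠ dhaf B Δ k r) l
      ≈⟨ Σsel-cong (λ z r → solve 6
           (λ a b c d h e → (a :* b :+ c :* d) :* h :+ e := a :* (b :* h) :+ (c :* (d :* h) :+ e)) refl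
           (B u w) (B v z) (B u z) (B v w) (haf B k r) (B w z ⊠ dhaf B Δ k r)) l ⟩
    Σsel (λ z r → B u w ⊠ (B v z ⊠ haf B k r) ⊞ (B u z ⊠ (B v w ⊠ haf B k r) ⊞ B w z ⊠ dhaf B Δ k r)) l
      ≈⟨ trans (Σsel-+ l) (+-cong (Σsel-* (B u w) l) (Σsel-+ l)) ⟩
    B u w ⊠ haf B (suc k) (v ∷ l) ⊞
      (Σsel (λ z r → B u z ⊠ (B v w ⊠ haf B k r)) l ⊞ Σsel (λ z r → B w z ⊠ dhaf B Δ k r) l)
      ≈⟨ +-congˡ (+-congˡ (trans (Σsel-cong (λ z r → *-congˡ (dhaf-detour B u v k r)) l) (third k))) ⟩
    B u w ⊠ haf B (suc k) (v ∷ l) ⊞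
      (Σsel (λ z r → B u z ⊠ (B v w ⊠ haf B k r)) l ⊞
       Σsel (λ a r → B u a ⊠ Σsel (λ b s → B v b ⊠ haf B k (w ∷ s)) r) l)
      ≈⟨ +-congˡ (Σsel-+ l) ⟨
    B u w ⊠ haf B (suc k) (v ∷ l) ⊞
      Σsel (λ a r → B u a ⊠ (B v w ⊠ haf B k r) ⊞ B u a ⊠ Σsel (λ b s → B v b ⊠ haf B k (w ∷ s)) r) l
      ≈⟨ +-congˡ (Σsel-cong (λ a r → solve 3 (λ a b c → a :* b :+ a :* c := a :* (b :+ c)) refl _ _ _) l) ⟩
    B u w ⊠ haf B (suc k) (v ∷ l) ⊞ Σsel (λ a r → B u a ⊠ haf B (suc k) (v ∷ w ∷ r)) l ∎
    where
    Δ = detour B u v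

    -- Both sides choose partners of `u`, `v` and `w`; two exchanges of sums move the choice for `w`
    -- from first to last. At `zero` both sides vanish, because `haf` with no edges is 0 on a
    -- nonempty list.
    third : ∀ k → Σsel (λ z r → B w z ⊠ Σsel (λ a s → B u a ⊠ haf B k (v ∷ s)) r) l ≈
                  Σsel (λ a r → B u a ⊠ Σsel (λ b s → B v b ⊠ haf B k (w ∷ s)) r) l
    third zero = Σsel-cong (λ x y → begin
      _ ≈⟨ *-congˡ (trans (Σsel-cong (λ _ _ → zeroʳ _) y) (Σsel-zero y)) ⟩
      B w x ⊠ 𝟎 ≈⟨ trans (zeroʳ _) (sym (zeroʳ _)) ⟩
      B u x ⊠ 𝟎 ≈⟨ *-congˡ (trans (Σsel-cong (λ _ _ → zeroʳ _) y) (Σsel-zero y)) ⟨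
      _ ∎) l
    third (suc k) = begin
      Σsel (λ z r → B w z ⊠ Σsel (λ a s → B u a ⊠ Σsel (λ b t → B v b ⊠ haf B k t) s) r) l
        ≈⟨ Σsel-cong (λ z r → Σsel-* (B w z) r) l ⟨
      Σsel (λ z → Σsel (λ a s → B w z ⊠ (B u a ⊠ Σsel (λ b t → B v b ⊠ haf B k t) s))) l
        ≈⟨ Σsel-swap _ l ⟩
      Σsel (λ a → Σsel (λ z s → B w z ⊠ (B u a ⊠ Σsel (λ b t → B v b ⊠ haf B k t) s))) l
        ≈⟨ Σsel-cong (λ a r → trans (Σsel-cong (λ z s →
             solve 3 (λ x y s → x :* (y :* s) := y :* (x :* s)) refl _ _ _) r) (Σsel-* (B u a) r)) l ⟩
      Σsel (λ a r → B u a ⊠ Σsel (λ z s → B w z ⊠ Σsel (λ b t → B v b ⊠ haf B k t) s) r) l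
        ≈⟨ Σsel-cong (λ a r → *-congˡ (begin
             Σsel (λ z s → B w z ⊠ Σsel (λ b t → B v b ⊠ haf B k t) s) r
               ≈⟨ Σsel-cong (λ z s → Σsel-* (B w z) s) r ⟨
             Σsel (λ z → Σsel (λ b t → B w z ⊠ (B v b ⊠ haf B k t))) r
               ≈⟨ Σsel-swap _ r ⟩
             Σsel (λ b → Σsel (λ z t → B w z ⊠ (B v b ⊠ haf B k t))) r
               ≈⟨ Σsel-cong (λ b s → trans (Σsel-cong (λ z t →
                    solve 3 (λ x y h → x :* (y :* h) := y :* (x :* h)) refl _ _ _) s) (Σsel-* (B v b) s)) r ⟩
             Σsel (λ b s → B v b ⊠ Σsel (λ z t → B w z ⊠ haf B k t) s) r ∎)) l ⟩
      Σsel (λ a r → B u a ⊠ Σsel (λ b s → B v b ⊠ Σsel (λ z t → B w z ⊠ haf B k t) s) r) l ∎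

  haf-pair : ∀ B u v k l →
    haf B (suc k) (u ∷ v ∷ l) ≈ B u v ⊠ haf B k l ⊞ dhaf B (detour B u v) k l
  haf-pair B u v k l = +-congˡ (sym (dhaf-detour B u v k l))

-- A semiring with an element `-𝟏` plays the role of a ring, so that ℕ modulo `W` with its ordinary
-- operations is an instance. `X` belongs to the structure because homomorphisms have to preserve
-- it.
record Base : Set₁ where
  field
    semiring : CommutativeSemiring 0ℓ 0ℓ
  open CommutativeSemiring semiring public
    using (_≈_; refl; sym; trans; setoid; +-cong; *-cong; +-congˡ; *-congˡ; +-congʳ; *-congʳ; +-identityˡ;
            +-identityʳ; zeroˡ; zeroʳ; *-identityˡ; *-identityʳ)
    renaming (Carrier to C; _+_ to _⊞_; _*_ to _⊠_; 0# to 𝟎; 1# to 𝟏)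
  field
    X  : C
    -𝟏 : C
    𝟏+-𝟏≈𝟎 : 𝟏 ⊞ -𝟏 ≈ 𝟎

module Alternating (R : Base) (A : Set) where
  open Base R
  open Hafnian semiring A public

  shift : (A → A → C) → A → A → A → A → C
  shift B u v i j = B i j ⊞ X ⊠ detour B u v i j

  alt : (A → A → C) → ℕ → List A → C
  alt B zero    []          = 𝟏
  alt B zero    (_ ∷ _)     = 𝟎
  alt B (suc k) []          = 𝟎
  alt B (suc k) (_ ∷ [])    = 𝟎
  alt B (suc k) (u ∷ v ∷ l) = (𝟏 ⊞ X ⊠ B u v) ⊠ alt (shift B u v) k l ⊞ -𝟏 ⊠ alt B k l

  alt-cong : ∀ {B B′} → (∀ i j → B i j ≈ B′ i j) → ∀ k l → alt B k l ≈ alt B′ k l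
  alt-cong B≈B′ zero    []          = refl
  alt-cong B≈B′ zero    (_ ∷ _)     = refl
  alt-cong B≈B′ (suc k) []          = refl
  alt-cong B≈B′ (suc k) (_ ∷ [])    = refl
  alt-cong B≈B′ (suc k) (u ∷ v ∷ l) = +-cong
    (*-cong (+-congˡ (*-congˡ (B≈B′ u v)))
      (alt-cong (λ i j → +-cong (B≈B′ i j)
        (*-congˡ (+-cong (*-cong (B≈B′ u i) (B≈B′ v j)) (*-cong (B≈B′ u j) (B≈B′ v i))))) k l))
    (*-congˡ (alt-cong B≈B′ k l))

  pow : ℕ → C
  pow zero    = 𝟏
  pow (suc k) = X ⊠ pow k

record Hom (R R′ : Base) : Set where
  private
    module R = Base R
    module R′ = Base R′
  field
    φ       : R.C → R′.C
    φ-cong  : ∀ {a b} → a R.≈ b → φ a R′.≈ φ b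
    φ-+     : ∀ a b → φ (a R.⊞ b) R′.≈ φ a R′.⊞ φ b
    φ-*     : ∀ a b → φ (a R.⊠ b) R′.≈ φ a R′.⊠ φ b
    φ-0     : φ R.𝟎 R′.≈ R′.𝟎
    φ-1     : φ R.𝟏 R′.≈ R′.𝟏
    φ-X     : φ R.X R′.≈ R′.X
    φ-neg   : φ R.-𝟏 R′.≈ R′.-𝟏

module _ {R R′ : Base} (h : Hom R R′) {A : Set} where
  open Hom h
  private
    module R  = Base R
    module AR = Alternating R A
  open Base R′
  open Alternating R′ A
  open import Relation.Binary.Reasoning.Setoid setoid

  φ-alt : ∀ B k l → φ (AR.alt B k l) ≈ alt (λ i j → φ (B i j)) k l
  φ-alt B zero    []          = φ-1
  φ-alt B zero    (_ ∷ _)     = φ-0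
  φ-alt B (suc k) []          = φ-0
  φ-alt B (suc k) (_ ∷ [])    = φ-0
  φ-alt B (suc k) (u ∷ v ∷ l) = trans (φ-+ _ _) (+-cong
    (trans (φ-* _ _) (*-cong
      (trans (φ-+ _ _) (+-cong φ-1 (trans (φ-* _ _) (*-congʳ φ-X))))
      (trans (φ-alt (AR.shift B u v) k l) (alt-cong φ-shift k l))))
    (trans (φ-* _ _) (*-cong φ-neg (φ-alt B k l))))
    where
    φ-shift : ∀ i j → φ (AR.shift B u v i j) ≈ shift (λ i j → φ (B i j)) u v i j
    φ-shift i j = trans (φ-+ _ _) (+-congˡ (trans (φ-* _ _) (*-cong φ-X
      (trans (φ-+ _ _) (+-cong (φ-* _ _) (φ-* _ _))))))

  φ-pow : ∀ k → φ (AR.pow k) ≈ pow k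
  φ-pow zero    = φ-1
  φ-pow (suc k) = trans (φ-* _ _) (*-cong φ-X (φ-pow k))

-- R[x] modulo x² = X x, where (a , b) represents a + b x.
module Extension (R : Base) where
  open Base R
  open SemiringSolver semiring using (solve; _:+_; _:*_; _:=_; con)

  extension : Base
  extension = record
    { semiring = record
      { Carrier = C × C
      ; _≈_ = λ (a , b) (c , d) → a ≈ c × b ≈ d
      ; _+_ = λ (a , b) (c , d) → a ⊞ c , b ⊞ d
      ; _*_ = λ (a , b) (c , d) → a ⊠ c , a ⊠ d ⊞ b ⊠ c ⊞ X ⊠ (b ⊠ d)
      ; 0# = 𝟎 , 𝟎
      ; 1# = 𝟏 , 𝟎
      ; isCommutativeSemiring = isCommutativeSemiringˡ record
        { +-isCommutativeMonoid = record
          { isMonoid = record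
            { isSemigroup = record
              { isMagma = record
                { isEquivalence = equiv
                ; ∙-cong = λ (p , q) (p′ , q′) → +-cong p p′ , +-cong q q′ }
              ; assoc = λ _ _ _ → CS.+-assoc _ _ _ , CS.+-assoc _ _ _ }
            ; identity = (λ _ → +-identityˡ _ , +-identityˡ _) , (λ _ → +-identityʳ _ , +-identityʳ _) }
          ; comm = λ _ _ → CS.+-comm _ _ , CS.+-comm _ _ }
        ; *-isCommutativeMonoid = record
          { isMonoid = record
            { isSemigroup = record
              { isMagma = record
                { isEquivalence = equiv
                ; ∙-cong = λ (p , q) (p′ , q′) → *-cong p p′ ,
                    +-cong (+-cong (*-cong p q′) (*-cong q p′)) (*-congˡ (*-cong q q′)) }
              ; assoc = λ (a , b) (c , d) (e , f) → CS.*-assoc _ _ _ ,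
                  solve 7 (λ X a b c d e f →
                    a :* c :* f :+ (a :* d :+ b :* c :+ X :* (b :* d)) :* e :+ X :* ((a :* d :+ b :* c :+ X :* (b :* d)) :* f) :=
                    a :* (c :* f :+ d :* e :+ X :* (d :* f)) :+ b :* (c :* e) :+ X :* (b :* (c :* f :+ d :* e :+ X :* (d :* f))))
                    refl X a b c d e f }
            ; identity =
                (λ (a , b) → *-identityˡ a , solve 3 (λ X a b → con 1 :* b :+ con 0 :* a :+ X :* (con 0 :* b) := b) refl X a b) ,
                (λ (a , b) → *-identityʳ a , solve 3 (λ X a b → a :* con 0 :+ b :* con 1 :+ X :* (b :* con 0) := b) refl X a b) }
          ; comm = λ (a , b) (c , d) → CS.*-comm _ _ ,
              solve 5 (λ X a b c d → a :* d :+ b :* c :+ X :* (b :* d) := c :* b :+ d :* a :+ X :* (d :* b)) refl X a b c d }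
        ; distribʳ = λ (a , b) (c , d) (e , f) → CS.distribʳ _ _ _ ,
            solve 7 (λ X a b c d e f →
              (c :+ e) :* b :+ (d :+ f) :* a :+ X :* ((d :+ f) :* b) :=
              (c :* b :+ d :* a :+ X :* (d :* b)) :+ (e :* b :+ f :* a :+ X :* (f :* b))) refl X a b c d e f
        ; zeroˡ = λ (a , b) → zeroˡ a , solve 3 (λ X a b → con 0 :* b :+ con 0 :* a :+ X :* (con 0 :* b) := con 0) refl X a b
        } }
    ; X = X , 𝟎
    ; -𝟏 = -𝟏 , 𝟎
    ; 𝟏+-𝟏≈𝟎 = 𝟏+-𝟏≈𝟎 , +-identityˡ _
    }
    where
    module CS = CommutativeSemiring semiring
    equiv : IsEquivalence {A = C × C} (λ (a , b) (c , d) → a ≈ c × b ≈ d)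
    equiv = record
      { refl = refl , refl
      ; sym = λ (p , q) → sym p , sym q
      ; trans = λ (p , q) (p′ , q′) → trans p p′ , trans q q′ }

  -- The equation x² = X x has the roots 0 and X, so evaluation at either one respects
  -- multiplication.
  at-0 : Hom extension R
  at-0 = record
    { φ = proj₁ ; φ-cong = proj₁ ; φ-+ = λ _ _ → refl ; φ-* = λ _ _ → refl
    ; φ-0 = refl ; φ-1 = refl ; φ-X = refl ; φ-neg = refl }

  at-X : Hom extension R
  at-X = record
    { φ = λ (a , b) → a ⊞ X ⊠ b
    ; φ-cong = λ (p , q) → +-cong p (*-congˡ q)
    ; φ-+ = λ (a , b) (c , d) → solve 5 (λ X a b c d → a :+ c :+ X :* (b :+ d) := a :+ X :* b :+ (c :+ X :* d)) refl X a b c d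
    ; φ-* = λ (a , b) (c , d) → solve 5 (λ X a b c d →
        a :* c :+ X :* (a :* d :+ b :* c :+ X :* (b :* d)) := (a :+ X :* b) :* (c :+ X :* d)) refl X a b c d
    ; φ-0 = φ-const 𝟎 ; φ-1 = φ-const 𝟏 ; φ-X = φ-const X ; φ-neg = φ-const -𝟏 }
    where
    φ-const : ∀ a → a ⊞ X ⊠ 𝟎 ≈ a
    φ-const a = trans (+-congˡ (zeroʳ X)) (+-identityʳ a)

  module _ {A : Set} where
    open Hafnian semiring A
    private module E = Hafnian (Base.semiring extension) A

    Σsel-proj₁ : ∀ {f} l → proj₁ (E.Σsel f l) ≈ Σsel (λ a r → proj₁ (f a r)) l
    Σsel-proj₁ []      = refl
    Σsel-proj₁ (w ∷ l) = +-congˡ (Σsel-proj₁ l)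

    Σsel-proj₂ : ∀ {f} l → proj₂ (E.Σsel f l) ≈ Σsel (λ a r → proj₂ (f a r)) l
    Σsel-proj₂ []      = refl
    Σsel-proj₂ (w ∷ l) = +-congˡ (Σsel-proj₂ l)

    module _ (B Δ : A → A → C) where
      private
        B′ : A → A → C × C
        B′ i j = B i j , Δ i j

      proj₁-haf : ∀ k l → proj₁ (E.haf B′ k l) ≈ haf B k l
      proj₁-haf zero    []      = refl
      proj₁-haf zero    (_ ∷ _) = refl
      proj₁-haf (suc k) []      = refl
      proj₁-haf (suc k) (u ∷ l) = trans (Σsel-proj₁ l) (Σsel-cong (λ v r → *-congˡ (proj₁-haf k r)) l)

      -- By x² = X x, the product of `Δ u v` with the x-part of the smaller hafnian returns as `X`
      -- times an x-term and is absorbed by the error `e`.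
      proj₂-haf : ∀ k l → ∃[ e ] proj₂ (E.haf B′ k l) ≈ dhaf B Δ k l ⊞ X ⊠ e
      proj₂-haf zero    []      = 𝟎 , sym (trans (+-identityˡ _) (zeroʳ X))
      proj₂-haf zero    (_ ∷ _) = 𝟎 , sym (trans (+-identityˡ _) (zeroʳ X))
      proj₂-haf (suc k) []      = 𝟎 , sym (trans (+-identityˡ _) (zeroʳ X))
      proj₂-haf (suc k) (u ∷ l) = Σsel (λ v r → B u v ⊠ e r ⊞ Δ u v ⊠ proj₂ (E.haf B′ k r)) l ,
        trans (Σsel-proj₂ l) (trans (Σsel-cong (λ v r →
          trans (+-congʳ (+-cong (*-congˡ (proj₂ (proj₂-haf k r))) (*-congˡ (proj₁-haf k r))))
            (solve 7 (λ X b δ h d e p →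
              b :* (d :+ X :* e) :+ δ :* h :+ X :* (δ :* p) := δ :* h :+ b :* d :+ X :* (b :* e :+ δ :* p))
              refl X (B u v) (Δ u v) (haf B k r) (dhaf B Δ k r) (e r) _)) l)
        (trans (Σsel-+ l) (+-congˡ (Σsel-* X l))))
        where
        e : List A → C
        e r = proj₁ (proj₂-haf k r)

-- Replacing X by a new variable x with x² = X x turns the difference of the two
-- terms of alt into X times the coefficient of x.  Modulo X, this coefficient
-- is a derivative, because x² vanishes.
alt-haf : ∀ (R : Base) {A : Set} → let open Base R; open Alternating R A in
  ∀ B k l → ∃[ r ] alt B k l ≈ pow k ⊠ (haf B k l ⊞ X ⊠ r)
alt-haf R B zero    []      = 𝟎 , sym (trans (*-identityˡ _) (trans (+-congˡ (zeroʳ X)) (+-identityʳ _)))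
  where open Base R
alt-haf R B zero    (_ ∷ _) = 𝟎 , sym (trans (*-identityˡ _) (trans (+-congˡ (zeroʳ X)) (+-identityʳ _)))
  where open Base R
alt-haf R B (suc k) []      = 𝟎 , sym (trans (*-congˡ (trans (+-congˡ (zeroʳ X)) (+-identityʳ _))) (zeroʳ _))
  where open Base R
alt-haf R B (suc k) (_ ∷ []) = 𝟎 , sym (trans (*-congˡ (trans (+-congˡ (zeroʳ X)) (+-identityʳ _))) (zeroʳ _))
  where open Base R
alt-haf R {A} B (suc k) (u ∷ v ∷ l) = r , (begin
    (𝟏 ⊞ X ⊠ b) ⊠ alt (shift B u v) k l ⊞ -𝟏 ⊠ alt B k l
      -- The one identity `eq′` over the extension, mapped by x = X and by x = 0, expands both
      -- summands in terms of the same `q`.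
      ≈⟨ +-cong (*-congˡ (trans (sym (φ-alt at-X B′ k l)) (trans (Hom.φ-cong at-X eq′)
                  (trans (Hom.φ-* at-X _ _) (*-cong (φ-pow at-X {A} k) (+-cong (+-congˡ refl) refl))))))
                (*-congˡ (trans (sym (φ-alt at-0 B′ k l)) (trans (proj₁ eq′) (*-congʳ (φ-pow at-0 {A} k))))) ⟩
    (𝟏 ⊞ X ⊠ b) ⊠ (pow k ⊠ (proj₁ q ⊞ X ⊠ proj₂ q)) ⊞ -𝟏 ⊠ (pow k ⊠ proj₁ q)
      ≈⟨ solve 7 (λ X b ν p q₀ q₁ o →
           (o :+ X :* b) :* (p :* (q₀ :+ X :* q₁)) :+ ν :* (p :* q₀) :=
           (o :+ ν) :* (p :* q₀) :+ (X :* p) :* (b :* q₀ :+ o :* q₁ :+ X :* (b :* q₁))) refl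
           X b -𝟏 (pow k) (proj₁ q) (proj₂ q) 𝟏 ⟩
    -- The terms of order X^k share the factor 1 + (-1) and cancel; all others carry one more factor
    -- `X`.
    (𝟏 ⊞ -𝟏) ⊠ (pow k ⊠ proj₁ q) ⊞ pow (suc k) ⊠ (b ⊠ proj₁ q ⊞ 𝟏 ⊠ proj₂ q ⊞ X ⊠ (b ⊠ proj₂ q))
      ≈⟨ trans (+-congʳ (trans (*-congʳ 𝟏+-𝟏≈𝟎) (zeroˡ _))) (+-identityˡ _) ⟩
    pow (suc k) ⊠ (b ⊠ proj₁ q ⊞ 𝟏 ⊠ proj₂ q ⊞ X ⊠ (b ⊠ proj₂ q))
      ≈⟨ *-congˡ (+-congʳ (+-cong (*-congˡ (+-congʳ (proj₁-haf B Δ k l)))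
           (trans (*-identityˡ _) (+-congʳ (proj₂ (proj₂-haf B Δ k l)))))) ⟩
    pow (suc k) ⊠
      (b ⊠ (haf B k l ⊞ X ⊠ proj₁ r′) ⊞ ((dhaf B Δ k l ⊞ X ⊠ e) ⊞ proj₂ (X′ E.⊠ r′)) ⊞ X ⊠ (b ⊠ proj₂ q))
      ≈⟨ *-congˡ (solve 9 (λ X b h d e r₀ r₁ s o →
           b :* (h :+ X :* r₀) :+ ((d :+ X :* e) :+ (X :* r₁ :+ con 0 :* r₀ :+ X :* (con 0 :* r₁))) :+ X :* (b :* s) :=
           (b :* h :+ d) :+ X :* (b :* r₀ :+ e :+ r₁ :+ b :* s)) refl
           X b (haf B k l) (dhaf B Δ k l) e (proj₁ r′) (proj₂ r′) (proj₂ q) 𝟏) ⟩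
    pow (suc k) ⊠ ((b ⊠ haf B k l ⊞ dhaf B Δ k l) ⊞ X ⊠ r)
      ≈⟨ *-congˡ (+-congʳ (haf-pair B u v k l)) ⟨
    pow (suc k) ⊠ (haf B (suc k) (u ∷ v ∷ l) ⊞ X ⊠ r) ∎)
  where
  open Base R
  open Alternating R A
  open Extension R
  open SemiringSolver semiring using (solve; _:+_; _:*_; _:=_; con)
  open import Relation.Binary.Reasoning.Setoid setoid
  module E = Base extension
  module AE = Alternating extension A

  b = B u v
  Δ = detour B u v
  X′ = E.X

  B′ : A → A → E.C
  B′ i j = B i j , Δ i j

  r′ : E.C
  -- The recursion is polymorphic: `k` decreases while the ring gains one variable for each pair.
  r′ = proj₁ (alt-haf extension B′ k l)

  q : E.C
  q = AE.haf B′ k l E.⊞ E.X E.⊠ r′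

  eq′ : AE.alt B′ k l E.≈ AE.pow k E.⊠ q
  eq′ = proj₂ (alt-haf extension B′ k l)

  e : C
  e = proj₁ (proj₂-haf B Δ k l)

  r : C
  r = b ⊠ proj₁ r′ ⊞ e ⊞ proj₂ r′ ⊞ b ⊠ proj₂ q

-- Computing modulo W

open import Data.Nat.Properties

pairs : ℕ → ℕ → List ℕ
pairs p zero    = []
pairs p (suc m) = 2 * p ∷ suc (2 * p) ∷ pairs (suc p) m

∑ : ℕ → (ℕ → ℕ) → ℕ
∑ zero    f = 0
∑ (suc k) f = ∑ k f + f k

∑-double : ∀ k f → ∑ (2 * k) f ≡ ∑ k (λ i → f (2 * i) + f (suc (2 * i)))
∑-double zero    f = ≡.refl
∑-double (suc k) f rewrite +-suc k (k + 0) =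
  ≡.trans (+-assoc (∑ (2 * k) f) _ _) (cong (_+ (f (2 * k) + f (suc (2 * k)))) (∑-double k f))

-- The remainder modulo 2 in the shape of the program expression `digit`, so that the two agree by
-- computation.
lowBit : ℕ → ℕ
lowBit z = z ∸ z / 2 * 2

[2*y]/2≡y : ∀ y → 2 * y / 2 ≡ y
[2*y]/2≡y y = ≡.trans (cong (_/ 2) (*-comm 2 y)) (m*n/n≡m y 2)

[1+2*y]/2≡y : ∀ y → suc (2 * y) / 2 ≡ y
[1+2*y]/2≡y y = ≡.trans (+-distrib-/-∣ʳ 1 (divides y (*-comm 2 y))) ([2*y]/2≡y y)

lowBit-even : ∀ y → lowBit (2 * y) ≡ 0
lowBit-even y rewrite [2*y]/2≡y y | *-comm y 2 = n∸n≡0 (2 * y)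

lowBit-odd : ∀ y → lowBit (suc (2 * y)) ≡ 1
lowBit-odd y rewrite [1+2*y]/2≡y y | *-comm y 2 = m+n∸n≡m 1 (2 * y)

module Modular (W X : ℕ) .{{_ : NonZero W}} where

  infix 4 _≈_
  -- A record, so that `a` and `b` can be inferred from the type, which an equation between
  -- remainders would not allow.
  record _≈_ (a b : ℕ) : Set where
    constructor mod
    field residue : a % W ≡ b % W
  open _≈_ public

  private
    +-cong-≈ : ∀ {a b c d} → a ≈ b → c ≈ d → a + c ≈ b + d
    +-cong-≈ {a} {b} {c} {d} (mod p) (mod q) = mod (≡.trans (%-distribˡ-+ a c W)
      (≡.trans (cong (_% W) (cong₂ _+_ p q)) (≡.sym (%-distribˡ-+ b d W))))

    *-cong-≈ : ∀ {a b c d} → a ≈ b → c ≈ d → a * c ≈ b * d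
    *-cong-≈ {a} {b} {c} {d} (mod p) (mod q) = mod (≡.trans (%-distribˡ-* a c W)
      (≡.trans (cong (_% W) (cong₂ _*_ p q)) (≡.sym (%-distribˡ-* b d W))))

  ≡⇒≈ : ∀ {a b} → a ≡ b → a ≈ b
  ≡⇒≈ eq = mod (cong (_% W) eq)

  modular : Base
  modular = record
    { semiring = record
      { Carrier = ℕ ; _≈_ = _≈_ ; _+_ = _+_ ; _*_ = _*_ ; 0# = 0 ; 1# = 1
      ; isCommutativeSemiring = isCommutativeSemiringˡ record
        { +-isCommutativeMonoid = record
          { isMonoid = record
            { isSemigroup = record
              { isMagma = record { isEquivalence = equiv ; ∙-cong = +-cong-≈ }
              ; assoc = λ a b c → ≡⇒≈ (+-assoc a b c) }
            ; identity = (λ _ → ≡⇒≈ ≡.refl) , (λ a → ≡⇒≈ (+-identityʳ a)) }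
          ; comm = λ a b → ≡⇒≈ (+-comm a b) }
        ; *-isCommutativeMonoid = record
          { isMonoid = record
            { isSemigroup = record
              { isMagma = record { isEquivalence = equiv ; ∙-cong = *-cong-≈ }
              ; assoc = λ a b c → ≡⇒≈ (*-assoc a b c) }
            ; identity = (λ a → ≡⇒≈ (*-identityˡ a)) , (λ a → ≡⇒≈ (*-identityʳ a)) }
          ; comm = λ a b → ≡⇒≈ (*-comm a b) }
        ; distribʳ = λ a b c → ≡⇒≈ (*-distribʳ-+ a b c)
        ; zeroˡ = λ _ → ≡⇒≈ ≡.refl } }
    ; X = X
    ; -𝟏 = W ∸ 1
    ; 𝟏+-𝟏≈𝟎 = mod (≡.trans (cong (_% W) (suc-pred W)) (≡.trans (n%n≡0 W) (≡.sym (m*n%n≡0 0 W))))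
    }
    where
    equiv : IsEquivalence _≈_
    equiv = record
      { refl = mod ≡.refl
      ; sym = λ (mod p) → mod (≡.sym p)
      ; trans = λ (mod p) (mod q) → mod (≡.trans p q) }

  open Base modular public using (refl; sym; trans; +-cong; *-cong; +-congˡ; *-congˡ; +-congʳ; *-congʳ; setoid)
  open Alternating modular ℕ public

  -- For a bit `b` this selects without branching: 1 + X e, the coefficient of the shifted term of
  -- `alt`, if `b` is 1, and `W ∸ 1`, which stands for -1, if `b` is 0. Likewise `next` shifts the
  -- matrix exactly if `b` is 1.
  factor : ℕ → ℕ → ℕ
  factor b e = b * (1 + X * e) + (1 ∸ b) * (W ∸ 1)

  next : ℕ → ℕ → (ℕ → ℕ → ℕ) → ℕ → ℕ → ℕ
  next b p B i j = B i j + b * (X * detour B (2 * p) (suc (2 * p)) i j)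

  -- The term of the expansion of alt in which the binary digits of z say for
  -- each pair whether the first or the second summand is taken.
  leaf : ℕ → ℕ → ℕ → (ℕ → ℕ → ℕ) → ℕ
  leaf zero    p z B = 1
  leaf (suc m) p z B =
    factor (lowBit z) (B (2 * p) (suc (2 * p))) * leaf m (suc p) (z / 2) (next (lowBit z) p B)

  -- The table of the program agrees with the intended matrix only at indices below `n`. The bound
  -- on `p + m` keeps all remaining pairs in that range.
  leaf-cong : ∀ n m p z {B B′} → 2 * (p + m) ≤ n →
    (∀ i j → i < n → j < n → B i j ≈ B′ i j) → leaf m p z B ≈ leaf m p z B′
  leaf-cong n zero    p z le B≈B′ = refl
  leaf-cong n (suc m) p z {B} {B′} le B≈B′ = *-cong
    (+-congʳ (*-congˡ {lowBit z} (+-congˡ {1} (*-congˡ {X} (B≈B′ _ _ u<n v<n)))))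
    (leaf-cong n m (suc p) (z / 2) (≡.subst (λ k → 2 * k ≤ n) (+-suc p m) le)
      (λ i j i<n j<n → +-cong (B≈B′ i j i<n j<n) (*-congˡ {lowBit z} (*-congˡ {X}
        (+-cong (*-cong (B≈B′ _ _ u<n i<n) (B≈B′ _ _ v<n j<n))
                (*-cong (B≈B′ _ _ u<n j<n) (B≈B′ _ _ v<n i<n)))))))
    where
    v<n : suc (2 * p) < n
    v<n = ≤-trans (≤-trans (≤-reflexive (≡.sym (*-suc 2 p)))
      (*-monoʳ-≤ 2 (≤-trans (m≤m+n (suc p) m) (≤-reflexive (≡.sym (+-suc p m)))))) le

    u<n : 2 * p < n
    u<n = <-trans (n<1+n _) v<n

  private
    cong-leaf : ∀ m p z {B B′} → (∀ i j → B i j ≈ B′ i j) → leaf m p z B ≈ leaf m p z B′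
    cong-leaf m p z B≈B′ = leaf-cong (2 * (p + m)) m p z ≤-refl (λ i j _ _ → B≈B′ i j)

  ∑-cong : ∀ k {f g} → (∀ i → f i ≈ g i) → ∑ k f ≈ ∑ k g
  ∑-cong zero    eq = refl
  ∑-cong (suc k) eq = +-cong (∑-cong k eq) (eq k)

  ∑-linear : ∀ k a b (f g : ℕ → ℕ) → ∑ k (λ i → a * f i + b * g i) ≡ b * ∑ k g + a * ∑ k f
  ∑-linear zero    a b f g rewrite *-zeroʳ a | *-zeroʳ b = ≡.refl
  ∑-linear (suc k) a b f g rewrite ∑-linear k a b f g = solve 6
      (λ a b F G x y → b :* G :+ a :* F :+ (a :* x :+ b :* y) := b :* (G :+ y) :+ a :* (F :+ x))
      ≡.refl a b (∑ k f) (∑ k g) (f k) (g k)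
    where open +-*-Solver

  leaf-even : ∀ m p y B → leaf (suc m) p (2 * y) B ≈ (W ∸ 1) * leaf m (suc p) y B
  leaf-even m p y B rewrite lowBit-even y | [2*y]/2≡y y | +-identityʳ (W ∸ 1) =
    *-congˡ {W ∸ 1} (cong-leaf m (suc p) y (λ i j → ≡⇒≈ (+-identityʳ (B i j))))

  leaf-odd : ∀ m p y B → leaf (suc m) p (suc (2 * y)) B ≈
    (1 + X * B (2 * p) (suc (2 * p))) * leaf m (suc p) y (shift B (2 * p) (suc (2 * p)))
  leaf-odd m p y B rewrite lowBit-odd y | [1+2*y]/2≡y y =
    *-cong (≡⇒≈ (≡.trans (+-identityʳ _) (+-identityʳ (1 + X * B (2 * p) (suc (2 * p))))))
      (cong-leaf m (suc p) y (λ i j → ≡⇒≈ (cong (B i j +_) (+-identityʳ _))))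

  -- The lowest digit of z decides the first pair. Grouping the leaves 2 y and 2 y + 1 therefore
  -- exposes the two summands of `alt`, with the digits of y left for the other pairs.
  ∑-leaf : ∀ m p B → ∑ (2 ^ m) (λ z → leaf m p z B) ≈ alt B m (pairs p m)
  ∑-leaf zero    p B = refl
  ∑-leaf (suc m) p B =
    trans (≡⇒≈ (∑-double (2 ^ m) (λ z → leaf (suc m) p z B)))
    (trans (∑-cong (2 ^ m) (λ y → +-cong (leaf-even m p y B) (leaf-odd m p y B)))
    (trans (≡⇒≈ (∑-linear (2 ^ m) (W ∸ 1) (1 + X * B _ _) _ _))
      (+-cong (*-congˡ {1 + X * B (2 * p) (suc (2 * p))} (∑-leaf m (suc p) (shift B (2 * p) (suc (2 * p)))))
        (*-congˡ {W ∸ 1} (∑-leaf m (suc p) B)))))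

  pow≡^ : ∀ k → pow k ≡ X ^ k
  pow≡^ zero    = ≡.refl
  pow≡^ (suc k) = cong (X *_) (pow≡^ k)

module _ (X m : ℕ) .{{_ : NonZero X}} .{{nz : NonZero (X ^ suc m)}} where
  open Modular (X ^ suc m) X

  -- By `alt-haf` the sum is X^m (h + X r). The part with r is a multiple of the modulus, and h < X
  -- makes X^m h its own remainder, so the congruence becomes an equation.
  ∑-leaf-haf : ∀ B T → T < X ^ suc m → T ≈ ∑ (2 ^ m) (λ z → leaf m 0 z B) →
    haf B m (pairs 0 m) < X → T ≡ X ^ m * haf B m (pairs 0 m)
  ∑-leaf-haf B T T<W T≈ h<X = begin
    T                                     ≡⟨ m<n⇒m%n≡m T<W ⟨
    T % W                                 ≡⟨ residue (trans T≈ (trans (∑-leaf m 0 B) (proj₂ expansion))) ⟩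
    (pow m * (h + X * r)) % W             ≡⟨ cong (λ t → (t * (h + X * r)) % W) (pow≡^ m) ⟩
    (X ^ m * (h + X * r)) % W             ≡⟨ cong (_% W) (solve 4 (λ P h x r →
                                                P :* (h :+ x :* r) := P :* h :+ r :* (x :* P)) ≡.refl (X ^ m) h X r) ⟩
    (X ^ m * h + r * W) % W               ≡⟨ [m+kn]%n≡m%n (X ^ m * h) r W ⟩
    (X ^ m * h) % W                       ≡⟨ m<n⇒m%n≡m (≡.subst (X ^ m * h <_)
                                                (*-comm (X ^ m) X) (*-monoʳ-< (X ^ m) h<X)) ⟩
    X ^ m * h                             ∎
    where
    open ≡-Reasoning
    open +-*-Solver
    W = X ^ suc m
    h = haf B m (pairs 0 m)
    expansion = alt-haf modular B m (pairs 0 m)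
    r = proj₁ expansion
    instance
      nz′ : NonZero (X ^ m)
      nz′ = m^n≢0 X m

-- Enumerating the perfect matchings

module _ {A B : Set} where

  -- The counterpart of `Σsel` for lists: taking lengths turns one into the other, which is how the
  -- hafnian comes to count matchings.
  concatSel : (A → List A → List B) → List A → List B
  concatSel g []      = []
  concatSel g (w ∷ l) = g w l ++ concatSel (λ a r → g a (w ∷ r)) l

  ∈-concatSel⁻ : ∀ g l {x} → x ∈ᴸ concatSel g l → ∃[ a ] ∃[ r ] l ↭ a ∷ r × x ∈ᴸ g a r
  ∈-concatSel⁻ g (w ∷ l) x∈ with ∈-++⁻ (g w l) x∈
  ... | inj₁ x∈g = w , l , ↭-refl , x∈g
  ... | inj₂ x∈l =
    let a , r , l↭ , x∈g = ∈-concatSel⁻ (λ a r → g a (w ∷ r)) l x∈l in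
    a , w ∷ r , ↭-trans (prep w l↭) (swap w a ↭-refl) , x∈g

  ∈-concatSel⁺ : ∀ g l {x a} → a ∈ᴸ l → (∀ r → l ↭ a ∷ r → x ∈ᴸ g a r) → x ∈ᴸ concatSel g l
  ∈-concatSel⁺ g (w ∷ l) (here ≡.refl) x∈g = ∈-++⁺ˡ (x∈g l ↭-refl)
  ∈-concatSel⁺ g (w ∷ l) (there a∈l) x∈g = ∈-++⁺ʳ (g w l)
    (∈-concatSel⁺ (λ a r → g a (w ∷ r)) l a∈l
      (λ r l↭ → x∈g (w ∷ r) (↭-trans (prep w l↭) (swap w _ ↭-refl))))

  -- `K` reads off from x the element that was selected, so the lists for different selections are
  -- disjoint.
  Unique-concatSel : ∀ (K : A → B → Set) g l → Unique l →
    (∀ {a b x} → K a x → K b x → a ≡ b) →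
    (∀ a r → l ↭ a ∷ r → Unique (g a r) × (∀ {x} → x ∈ᴸ g a r → K a x)) →
    Unique (concatSel g l)
  Unique-concatSel K g []      _          K-inj ok = []
  Unique-concatSel K g (w ∷ l) (w∉l ∷ ul) K-inj ok = Unique.++⁺
    (proj₁ (ok w l ↭-refl))
    (Unique-concatSel K (λ a r → g a (w ∷ r)) l ul K-inj ok′)
    (λ (x∈g , x∈l) →
      let a , r , l↭ , x∈g′ = ∈-concatSel⁻ (λ a r → g a (w ∷ r)) l x∈l in
      All.lookup w∉l (∈-resp-↭ (↭-sym l↭) (here ≡.refl))
        (K-inj (proj₂ (ok w l ↭-refl) x∈g) (proj₂ (ok′ a r l↭) x∈g′)))
    where ok′ = λ a r l↭ → ok a (w ∷ r) (↭-trans (prep w l↭) (swap w a ↭-refl))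

module _ {n : ℕ} where

  fromDec : {P : Fin n → Fin n → Set} → Decidable P → Matrix n
  fromDec P? = tabulate λ i → tabulate λ j → does (P? i j)

  adj? : (M : Matrix n) → Decidable (Adj M)
  adj? M i j = j ∈? lookup M i

  module _ {P : Fin n → Fin n → Set} (P? : Decidable P) {i j : Fin n} where
    private
      entry : lookup (lookup (fromDec P?) i) j ≡ does (P? i j)
      entry = ≡.trans (cong (λ r → lookup r j) (lookup∘tabulate _ i)) (lookup∘tabulate _ j)

    fromDec⁺ : P i j → Adj (fromDec P?) i j
    fromDec⁺ p = lookup⇒[]= j _ (≡.trans entry (dec-true (P? i j) p))

    fromDec⁻ : Adj (fromDec P?) i j → P i j
    fromDec⁻ a with P? i j | ≡.trans (≡.sym entry) ([]=⇒lookup a)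
    ... | yes p | _  = p
    ... | no _  | ()

  Matrix-ext : {M N : Matrix n} → (∀ {i j} → Adj M i j → Adj N i j) → (∀ {i j} → Adj N i j → Adj M i j) → M ≡ N
  Matrix-ext {M} {N} M⇒N N⇒M = begin
    M                    ≡⟨ tabulate∘lookup M ⟨
    tabulate (lookup M)  ≡⟨ tabulate-cong (λ i → ⊆-antisym (M⇒N {i}) (N⇒M {i})) ⟩
    tabulate (lookup N)  ≡⟨ tabulate∘lookup N ⟩
    N                    ∎
    where open ≡-Reasoning

  IsPair : Fin n → Fin n → Fin n → Fin n → Set
  IsPair u v i j = (i ≡ u × j ≡ v) ⊎ (i ≡ v × j ≡ u)

  isPair? : ∀ u v → Decidable (IsPair u v)
  isPair? u v i j = (i Fin.≟ u ×-dec j Fin.≟ v) ⊎-dec (i Fin.≟ v ×-dec j Fin.≟ u)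

  IsPair-sym : ∀ {u v i j} → IsPair u v i j → IsPair u v j i
  IsPair-sym (inj₁ (p , q)) = inj₂ (q , p)
  IsPair-sym (inj₂ (p , q)) = inj₁ (q , p)

  empty : Matrix n
  empty = fromDec {λ _ _ → ⊥} (λ _ _ → no id)

  addEdge removeEdge : Fin n → Fin n → Matrix n → Matrix n
  addEdge    u v M = fromDec (λ i j → isPair? u v i j ⊎-dec adj? M i j)
  removeEdge u v M = fromDec (λ i j → ¬? (isPair? u v i j) ×-dec adj? M i j)

  module _ {u v : Fin n} {M : Matrix n} {i j : Fin n} where
    addEdge⁺ : IsPair u v i j ⊎ Adj M i j → Adj (addEdge u v M) i j
    addEdge⁺ = fromDec⁺ (λ i j → isPair? u v i j ⊎-dec adj? M i j)

    addEdge⁻ : Adj (addEdge u v M) i j → IsPair u v i j ⊎ Adj M i j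
    addEdge⁻ = fromDec⁻ (λ i j → isPair? u v i j ⊎-dec adj? M i j)

    removeEdge⁺ : ¬ IsPair u v i j → Adj M i j → Adj (removeEdge u v M) i j
    removeEdge⁺ ¬p a = fromDec⁺ (λ i j → ¬? (isPair? u v i j) ×-dec adj? M i j) (¬p , a)

    removeEdge⁻ : Adj (removeEdge u v M) i j → ¬ IsPair u v i j × Adj M i j
    removeEdge⁻ = fromDec⁻ (λ i j → ¬? (isPair? u v i j) ×-dec adj? M i j)

  module _ (G : Graph n) where

    -- Perfect matchings relative to a vertex list, so that induction can remove two vertices.
    -- `support`, with symmetry, leaves no edge that touches a vertex outside `l`; this determines
    -- the whole matrix.
    record IsMatchingOf (l : List (Fin n)) (M : Matrix n) : Set where
      field
        symm    : ∀ {i j} → Adj M i j → Adj M j i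
        sub     : ∀ {i j} → Adj M i j → Adj (edges G) i j
        covers  : ∀ {i} → i ∈ᴸ l → ∃! _≡_ (Adj M i)
        support : ∀ {i j} → Adj M i j → i ∈ᴸ l
    open IsMatchingOf

    matchings : ℕ → List (Fin n) → List (Matrix n)
    extend : ℕ → Fin n → Fin n → List (Fin n) → List (Matrix n)

    matchings zero    []      = empty ∷ []
    matchings zero    (_ ∷ _) = []
    matchings (suc k) []      = []
    matchings (suc k) (u ∷ l) = concatSel (extend k u) l

    extend k u v r with adj? (edges G) u v
    ... | yes _ = map (addEdge u v) (matchings k r)
    ... | no _  = []

    ∈-extend⁻ : ∀ k u v r {M} → M ∈ᴸ extend k u v r →
      Adj (edges G) u v × ∃[ M′ ] M′ ∈ᴸ matchings k r × M ≡ addEdge u v M′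
    ∈-extend⁻ k u v r M∈ with adj? (edges G) u v
    ... | yes uv = uv , ∈-map⁻ (addEdge u v) M∈

    ∈-extend⁺ : ∀ k u v r {M} → Adj (edges G) u v → M ∈ᴸ matchings k r →
      addEdge u v M ∈ᴸ extend k u v r
    ∈-extend⁺ k u v r uv M∈ with adj? (edges G) u v
    ... | yes _  = ∈-map⁺ (addEdge u v) M∈
    ... | no ¬uv = contradiction uv ¬uv

    module _ {u v : Fin n} {l r : List (Fin n)} (u∷l-unique : Unique (u ∷ l)) (l↭v∷r : l ↭ v ∷ r) where
      private
        l-unique : Unique l
        l-unique = AllPairs.tail u∷l-unique

      v∷r-unique : Unique (v ∷ r)
      v∷r-unique = Unique-resp-↭ (≡.setoid (Fin n)) (↭⇒↭ₛ l↭v∷r) l-unique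

      v∉r : v ∉ᴸ r
      v∉r = Unique.Unique[x∷xs]⇒x∉xs v∷r-unique

      u∉v∷r : u ∉ᴸ v ∷ r
      u∉v∷r u∈ = Unique.Unique[x∷xs]⇒x∉xs u∷l-unique (∈-resp-↭ (↭-sym l↭v∷r) u∈)

      private
        u∷l↭ : u ∷ l ↭ u ∷ v ∷ r
        u∷l↭ = prep u l↭v∷r

        r⇒u∷l : ∀ {i} → i ∈ᴸ r → i ∈ᴸ u ∷ l
        r⇒u∷l i∈ = ∈-resp-↭ (↭-sym u∷l↭) (there (there i∈))

      addEdge-matching : ∀ {M} → Adj (edges G) u v → IsMatchingOf r M →
        IsMatchingOf (u ∷ l) (addEdge u v M)
      addEdge-matching {M} uv m = record
        { symm    = λ a → addEdge⁺ {u} {v} {M} ([ inj₁ ∘ IsPair-sym , inj₂ ∘ symm m ]′ (addEdge⁻ {u} {v} {M} a))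
        ; sub     = λ a → sub′ (addEdge⁻ {u} {v} {M} a)
        ; covers  = λ i∈ → covers′ (∈-resp-↭ u∷l↭ i∈)
        ; support = λ a → support′ (addEdge⁻ {u} {v} {M} a)
        }
        where
        sub′ : ∀ {i j} → IsPair u v i j ⊎ Adj M i j → Adj (edges G) i j
        sub′ (inj₁ (inj₁ (≡.refl , ≡.refl))) = uv
        sub′ (inj₁ (inj₂ (≡.refl , ≡.refl))) = symmetric G uv
        sub′ (inj₂ a) = sub m a

        support′ : ∀ {i j} → IsPair u v i j ⊎ Adj M i j → i ∈ᴸ u ∷ l
        support′ (inj₁ (inj₁ (≡.refl , ≡.refl))) = here ≡.refl
        support′ (inj₁ (inj₂ (≡.refl , ≡.refl))) = ∈-resp-↭ (↭-sym u∷l↭) (there (here ≡.refl))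
        support′ (inj₂ a) = r⇒u∷l (support m a)

        from-u : ∀ {i j} → i ≡ u → IsPair u v i j ⊎ Adj M i j → v ≡ j
        from-u _      (inj₁ (inj₁ (_ , ≡.refl))) = ≡.refl
        from-u ≡.refl (inj₁ (inj₂ (u≡v , _)))    = contradiction (here u≡v) u∉v∷r
        from-u ≡.refl (inj₂ a)                   = contradiction (there (support m a)) u∉v∷r

        from-v : ∀ {i j} → i ≡ v → IsPair u v i j ⊎ Adj M i j → u ≡ j
        from-v _      (inj₁ (inj₂ (_ , ≡.refl))) = ≡.refl
        from-v ≡.refl (inj₁ (inj₁ (v≡u , _)))    = contradiction (here (≡.sym v≡u)) u∉v∷r
        from-v ≡.refl (inj₂ a)                   = contradiction (support m a) v∉r

        covers′ : ∀ {i} → i ∈ᴸ u ∷ v ∷ r → ∃! _≡_ (Adj (addEdge u v M) i)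
        covers′ (here ≡.refl) = v , addEdge⁺ {u} {v} {M} (inj₁ (inj₁ (≡.refl , ≡.refl))) ,
          λ a → from-u ≡.refl (addEdge⁻ {u} {v} {M} a)
        covers′ (there (here ≡.refl)) = u , addEdge⁺ {u} {v} {M} (inj₁ (inj₂ (≡.refl , ≡.refl))) ,
          λ a → from-v ≡.refl (addEdge⁻ {u} {v} {M} a)
        covers′ {i} (there (there i∈r)) =
          let j , a , unique = covers m i∈r in
          j , addEdge⁺ {u} {v} {M} (inj₂ a) , λ a′ → old unique (addEdge⁻ {u} {v} {M} a′)
          where
          old : ∀ {j k} → (∀ {k} → Adj M i k → j ≡ k) → IsPair u v i k ⊎ Adj M i k → j ≡ k
          old unique (inj₁ (inj₁ (≡.refl , _))) = contradiction (there i∈r) u∉v∷r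
          old unique (inj₁ (inj₂ (≡.refl , _))) = contradiction i∈r v∉r
          old unique (inj₂ a)                   = unique a

      module _ {M : Matrix n} (m : IsMatchingOf (u ∷ l) M) (uv : Adj M u v) where
        private
          partner-u : ∀ {j} → Adj M u j → v ≡ j
          partner-u a = let _ , _ , unique = covers m (here ≡.refl) in
            ≡.trans (≡.sym (unique uv)) (unique a)

          partner-v : ∀ {j} → Adj M v j → u ≡ j
          partner-v a =
            let _ , _ , unique = covers m (support m (symm m uv)) in
            ≡.trans (≡.sym (unique (symm m uv))) (unique a)

        removeEdge-matching : IsMatchingOf r (removeEdge u v M)
        removeEdge-matching = record
          { symm    = λ a → let ¬p , a′ = removeEdge⁻ {u} {v} {M} a in
              removeEdge⁺ {u} {v} {M} (¬p ∘ IsPair-sym) (symm m a′)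
          ; sub     = λ a → sub m (proj₂ (removeEdge⁻ {u} {v} {M} a))
          ; covers  = λ {i} i∈r →
              let j , a , unique = covers m (r⇒u∷l i∈r) in
              j , removeEdge⁺ {u} {v} {M} (not-pair i∈r) a , λ a′ → unique (proj₂ (removeEdge⁻ {u} {v} {M} a′))
          ; support = λ a → let ¬p , a′ = removeEdge⁻ {u} {v} {M} a in
              remains ¬p a′ (∈-resp-↭ u∷l↭ (support m a′))
          }
          where
          not-pair : ∀ {i j} → i ∈ᴸ r → ¬ IsPair u v i j
          not-pair i∈r (inj₁ (≡.refl , _)) = u∉v∷r (there i∈r)
          not-pair i∈r (inj₂ (≡.refl , _)) = v∉r i∈r

          remains : ∀ {i j} → ¬ IsPair u v i j → Adj M i j → i ∈ᴸ u ∷ v ∷ r → i ∈ᴸ r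
          remains ¬p a (here ≡.refl)         = contradiction (inj₁ (≡.refl , ≡.sym (partner-u a))) ¬p
          remains ¬p a (there (here ≡.refl)) = contradiction (inj₂ (≡.refl , ≡.sym (partner-v a))) ¬p
          remains ¬p a (there (there i∈r))   = i∈r

        addEdge-removeEdge : addEdge u v (removeEdge u v M) ≡ M
        addEdge-removeEdge = Matrix-ext
          (λ a → to (addEdge⁻ {u} {v} {removeEdge u v M} a))
          (λ {i} {j} a → addEdge⁺ {u} {v} {removeEdge u v M} (from (isPair? u v i j) a))
          where
          to : ∀ {i j} → IsPair u v i j ⊎ Adj (removeEdge u v M) i j → Adj M i j
          to (inj₁ (inj₁ (≡.refl , ≡.refl))) = uv
          to (inj₁ (inj₂ (≡.refl , ≡.refl))) = symm m uv
          to (inj₂ a)                        = proj₂ (removeEdge⁻ {u} {v} {M} a)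

          from : ∀ {i j} → Dec (IsPair u v i j) → Adj M i j → IsPair u v i j ⊎ Adj (removeEdge u v M) i j
          from (yes p) a = inj₁ p
          from (no ¬p) a = inj₂ (removeEdge⁺ {u} {v} {M} ¬p a)

    matchings-sound : ∀ k l → Unique l → ∀ {M} → M ∈ᴸ matchings k l → IsMatchingOf l M
    matchings-sound zero [] _ (here ≡.refl) = record
      { symm    = λ a → ⊥-elim (none a)
      ; sub     = λ a → ⊥-elim (none a)
      ; covers  = λ ()
      ; support = λ a → ⊥-elim (none a) }
      where
      none : ∀ {i j} → Adj empty i j → ⊥
      none = fromDec⁻ {λ _ _ → ⊥} (λ _ _ → no id)
    matchings-sound (suc k) (u ∷ l) ul M∈
      with v , r , l↭ , M∈′ ← ∈-concatSel⁻ (extend k u) l M∈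
      with uv , M′ , M′∈ , ≡.refl ← ∈-extend⁻ k u v r M∈′ =
      addEdge-matching ul l↭ uv (matchings-sound k r (AllPairs.tail (v∷r-unique ul l↭)) M′∈)

    -- The number of edges is produced rather than assumed, so the lemma also shows that a matching
    -- forces an even number of vertices. `d` is a bound for the recursion, since the rest `r` is
    -- not a sublist that Agda sees as smaller.
    matchings-complete : ∀ d l → length l ≤ d → Unique l → ∀ {M} → IsMatchingOf l M →
      ∃[ k ] length l ≡ 2 * k × M ∈ᴸ matchings k l
    matchings-complete d [] _ _ {M} m = 0 , ≡.refl , here (Matrix-ext
      (λ a → ⊥-elim (nowhere (support m a)))
      (λ a → ⊥-elim (fromDec⁻ {λ _ _ → ⊥} (λ _ _ → no id) a)))
      where
      nowhere : ∀ {i : Fin n} → i ∈ᴸ [] → ⊥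
      nowhere ()
    matchings-complete (suc d) (u ∷ l) (s≤s le) ul {M} m = suc k , len , M∈
      where
      v : Fin n
      v = proj₁ (covers m (here ≡.refl))

      uv : Adj M u v
      uv = proj₁ (proj₂ (covers m (here ≡.refl)))

      v∈l : v ∈ᴸ l
      v∈l with support m (symm m uv)
      ... | here v≡u  = contradiction (sub m uv) (loopless G (≡.sym v≡u))
      ... | there v∈l = v∈l

      rest : ∀ r → l ↭ v ∷ r → ∃[ k ] length r ≡ 2 * k × removeEdge u v M ∈ᴸ matchings k r
      rest r l↭ = matchings-complete d r
        (≤-trans (n≤1+n _) (≤-trans (≤-reflexive (≡.sym (↭-length l↭))) le))
        (AllPairs.tail (v∷r-unique ul l↭)) (removeEdge-matching ul l↭ m uv)

      removal : ∃[ r ] l ↭ v ∷ r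
      removal = remove v∈l
        where
        remove : ∀ {l} → v ∈ᴸ l → ∃[ r ] l ↭ v ∷ r
        remove {_ ∷ l} (here ≡.refl) = l , ↭-refl
        remove {w ∷ _} (there v∈)    = let r , l↭ = remove v∈ in w ∷ r , ↭-trans (prep w l↭) (swap w v ↭-refl)

      k : ℕ
      k = proj₁ (rest _ (proj₂ removal))

      len : suc (length l) ≡ 2 * suc k
      len = ≡.trans (cong suc (↭-length (proj₂ removal)))
        (≡.trans (cong (2 +_) (proj₁ (proj₂ (rest _ (proj₂ removal))))) (≡.sym (*-suc 2 k)))

      M∈ : M ∈ᴸ concatSel (extend k u) l
      -- Membership is needed for every rest `r`, while `k` was read off from one of them. All rests
      -- have the same length, hence the same `k`.
      M∈ = ∈-concatSel⁺ (extend k u) l v∈l λ r l↭ →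
        let k′ , len′ , M′∈ = rest r l↭
            k′≡k = *-cancelˡ-≡ k′ k 2 (suc-injective (suc-injective (≡.trans
              (cong (2 +_) (≡.sym len′)) (≡.trans (cong suc (≡.sym (↭-length l↭))) (≡.trans len (*-suc 2 k))))))
        in subst (_∈ᴸ extend k u v r) (addEdge-removeEdge ul l↭ m uv)
             (∈-extend⁺ k u v r (sub m uv) (subst (λ k → removeEdge u v M ∈ᴸ matchings k r) k′≡k M′∈))

    -- The unique neighbour of `u` in a matching reveals which `v` was selected. For fixed `v`,
    -- `removeEdge` undoes `addEdge` on matchings of the rest, so no duplicates arise there either.
    matchings-unique : ∀ k l → Unique l → Unique (matchings k l)
    matchings-unique zero    []      _  = All.[] ∷ []
    matchings-unique zero    (_ ∷ _) _  = []
    matchings-unique (suc k) []      _  = []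
    matchings-unique (suc k) (u ∷ l) ul = Unique-concatSel Partner (extend k u) l (AllPairs.tail ul)
        (λ (_ , unique) (a , _) → unique a)
        (λ v r l↭ → extend-unique v r l↭ , partner l↭)
      where
      Partner : Fin n → Matrix n → Set
      Partner v M = Adj M u v × (∀ {w} → Adj M u w → v ≡ w)

      partner : ∀ {v r} → l ↭ v ∷ r → ∀ {M} → M ∈ᴸ extend k u v r → Partner v M
      partner {v} {r} l↭ M∈ with uv , M′ , M′∈ , ≡.refl ← ∈-extend⁻ k u v r M∈ =
        let m = addEdge-matching ul l↭ uv (matchings-sound k r (AllPairs.tail (v∷r-unique ul l↭)) M′∈)
            _ , _ , unique = covers m (here ≡.refl)
            a = addEdge⁺ {u} {v} {M′} (inj₁ (inj₁ (≡.refl , ≡.refl)))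
        in a , λ a′ → ≡.trans (≡.sym (unique a)) (unique a′)

      extend-unique : ∀ v r → l ↭ v ∷ r → Unique (extend k u v r)
      extend-unique v r l↭ with adj? (edges G) u v
      ... | no _  = []
      ... | yes _ = map-unique (matchings-unique k r ur) (λ M∈ → removeEdge-addEdge (matchings-sound k r ur M∈))
        where
        ur = AllPairs.tail (v∷r-unique ul l↭)

        removeEdge-addEdge : ∀ {M} → IsMatchingOf r M → removeEdge u v (addEdge u v M) ≡ M
        removeEdge-addEdge {M} m = Matrix-ext
          (λ a → let ¬p , a′ = removeEdge⁻ {u} {v} {addEdge u v M} a in
             [ (λ p → contradiction p ¬p) , id ]′ (addEdge⁻ {u} {v} {M} a′))
          (λ a → removeEdge⁺ {u} {v} {addEdge u v M}
             (λ { (inj₁ (≡.refl , _)) → u∉v∷r ul l↭ (there (support m a))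
                ; (inj₂ (≡.refl , _)) → v∉r ul l↭ (support m a) })
             (addEdge⁺ {u} {v} {M} (inj₂ a)))

        map-unique : ∀ {Ms : List (Matrix n)} → Unique Ms →
          (∀ {M} → M ∈ᴸ Ms → removeEdge u v (addEdge u v M) ≡ M) → Unique (map (addEdge u v) Ms)
        map-unique {[]}     _        inv = []
        map-unique {M ∷ Ms} (M∉ ∷ u) inv = All.tabulate (λ N∈ eq →
          let N′ , N′∈ , N≡ = ∈-map⁻ (addEdge _ v) N∈ in
          All.lookup M∉ N′∈ (≡.trans (≡.sym (inv (here ≡.refl)))
            (≡.trans (cong (removeEdge _ v) (≡.trans eq N≡)) (inv (there N′∈))))) ∷ map-unique u (inv ∘ there)

    perfect⇒matching : ∀ {M} → IsPerfectMatching G M → IsMatchingOf (allFin n) M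
    perfect⇒matching pm = record
      { symm = symmetricᴹ ; sub = subset
      ; covers = λ {i} _ → perfect i ; support = λ {i} _ → ∈-allFin i }
      where open IsPerfectMatching pm

    perfect⇒matchings : ∀ {M} → IsPerfectMatching G M →
      ∃[ k ] n ≡ 2 * k × M ∈ᴸ matchings k (allFin n)
    perfect⇒matchings pm =
      let k , len , M∈ = matchings-complete n (allFin n) (≤-reflexive (length-tabulate id))
                           (Unique.allFin⁺ n) (perfect⇒matching pm)
      in k , ≡.trans (≡.sym (length-tabulate id)) len , M∈

    perfect-even : ∀ k → n ≡ 2 * k →
      HasCardinality (IsPerfectMatching G) (length (matchings k (allFin n)))
    perfect-even k n≡2k = matchings k (allFin n) , matchings-unique k _ unique ,
      (λ M → mk⇔ (λ M∈ → sound (matchings-sound k _ unique M∈)) complete) , ≡.refl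
      where
      unique = Unique.allFin⁺ n

      sound : ∀ {M} → IsMatchingOf (allFin n) M → IsPerfectMatching G M
      sound m = record { symmetricᴹ = symm m ; subset = sub m ; perfect = λ u → covers m (∈-allFin u) }

      complete : ∀ {M} → IsPerfectMatching G M → M ∈ᴸ matchings k (allFin n)
      complete {M} pm = let k′ , n≡2k′ , M∈ = perfect⇒matchings pm in
        subst (λ k → M ∈ᴸ matchings k (allFin n))
          (*-cancelˡ-≡ k′ k 2 (≡.trans (≡.sym n≡2k′) n≡2k)) M∈

    perfect-odd : (∀ k → n ≢ 2 * k) → HasCardinality (IsPerfectMatching G) 0
    perfect-odd odd = [] , [] ,
      (λ M → mk⇔ (λ ()) (λ pm → let k , n≡2k , _ = perfect⇒matchings pm in contradiction n≡2k (odd k))) ,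
      ≡.refl

    module _ (W X : ℕ) .{{_ : NonZero W}} (B : ℕ → ℕ → ℕ)
             (B≡ : ∀ i j → B (toℕ i) (toℕ j) ≡ (Bool.if does (adj? (edges G) i j) then 1 else 0)) where
      open Modular W X using (haf; Σsel)

      Σsel-length : ∀ {f} {g : Fin n → List (Fin n) → List (Matrix n)} →
        (∀ a r → f (toℕ a) (map toℕ r) ≡ length (g a r)) →
        ∀ l → Σsel f (map toℕ l) ≡ length (concatSel g l)
      Σsel-length eq []      = ≡.refl
      Σsel-length {f} {g} eq (w ∷ l) = ≡.trans
        (cong₂ _+_ (eq w l) (Σsel-length {λ a r → f a (toℕ w ∷ r)} (λ a r → eq a (w ∷ r)) l))
        (≡.sym (length-++ (g w l)))

      -- `modular` computes with the ordinary operations of ℕ, so `haf` is a true natural number and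
      -- the equation holds exactly, not just modulo `W`.
      haf-matchings : ∀ k l → haf B k (map toℕ l) ≡ length (matchings k l)
      haf-matchings zero    []      = ≡.refl
      haf-matchings zero    (_ ∷ _) = ≡.refl
      haf-matchings (suc k) []      = ≡.refl
      haf-matchings (suc k) (u ∷ l) = Σsel-length {λ v r → B (toℕ u) v * haf B k r} step l
        where
        step : ∀ v r → B (toℕ u) (toℕ v) * haf B k (map toℕ r) ≡ length (extend k u v r)
        step v r rewrite B≡ u v | haf-matchings k r with adj? (edges G) u v
        ... | yes _ = ≡.trans (+-identityʳ _) (≡.sym (length-map (addEdge u v) (matchings k r)))
        ... | no _  = ≡.refl

module _ (W X : ℕ) .{{_ : NonZero W}} where
  open Modular W X using (haf; Σsel)

  Σsel-≤ : ∀ {f : ℕ → List ℕ → ℕ} {c} l →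
    (∀ a r → suc (length r) ≡ length l → f a r ≤ c) → Σsel f l ≤ length l * c
  Σsel-≤ []      f≤c = z≤n
  Σsel-≤ (w ∷ l) f≤c = +-mono-≤ (f≤c w l ≡.refl) (Σsel-≤ l (λ a r eq → f≤c a (w ∷ r) (cong suc eq)))

  -- Each of the `k` edges leaves at most `d` choices for a partner.
  haf-≤ : ∀ (B : ℕ → ℕ → ℕ) d → (∀ i j → B i j ≤ 1) → ∀ k l → length l ≤ d → haf B k l ≤ d ^ k
  haf-≤ B d B≤1 zero    []      _  = ≤-refl
  haf-≤ B d B≤1 zero    (_ ∷ _) _  = z≤n
  haf-≤ B d B≤1 (suc k) []      _  = z≤n
  haf-≤ B d B≤1 (suc k) (u ∷ l) le = ≤-trans
    (Σsel-≤ l (λ v r len → ≤-trans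
      (*-mono-≤ (B≤1 u v) (haf-≤ B d B≤1 k r (≤-trans (n≤1+n _) (≤-trans (≤-reflexive len) (≤-trans (n≤1+n _) le)))))
      (≤-reflexive (*-identityˡ _))))
    (*-monoˡ-≤ (d ^ k) (≤-trans (n≤1+n _) le))

-- Reasoning about programs

n≤2^n : ∀ n → n ≤ 2 ^ n
n≤2^n zero    = z≤n
n≤2^n (suc n) = ≤-trans (+-mono-≤ (m^n>0 2 n) (n≤2^n n)) (≤-reflexive (cong (2 ^ n +_) (≡.sym (+-identityʳ _))))

n≤n*n : ∀ n → n ≤ n * n
n≤n*n zero    = z≤n
n≤n*n (suc n) = m≤m+n (suc n) (n * suc n)

read-write : ∀ xs a v → read (write xs a v) a ≡ v
read-write []       zero    v = ≡.refl
read-write []       (suc a) v = read-write [] a v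
read-write (x ∷ xs) zero    v = ≡.refl
read-write (x ∷ xs) (suc a) v = read-write xs a v

read-write-≢ : ∀ xs a v b → b ≢ a → read (write xs a v) b ≡ read xs b
read-write-≢ []       zero    v zero    b≢a = contradiction ≡.refl b≢a
read-write-≢ []       zero    v (suc b) b≢a = ≡.refl
read-write-≢ []       (suc a) v zero    b≢a = ≡.refl
read-write-≢ []       (suc a) v (suc b) b≢a = read-write-≢ [] a v b (b≢a ∘ cong suc)
read-write-≢ (x ∷ xs) zero    v zero    b≢a = contradiction ≡.refl b≢a
read-write-≢ (x ∷ xs) zero    v (suc b) b≢a = ≡.refl
read-write-≢ (x ∷ xs) (suc a) v zero    b≢a = ≡.refl
read-write-≢ (x ∷ xs) (suc a) v (suc b) b≢a = read-write-≢ xs a v b (b≢a ∘ cong suc)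

read-≤ : ∀ {xs b} → All (_≤ b) xs → ∀ i → read xs i ≤ b
read-≤ []       i       = z≤n
read-≤ (p ∷ ps) zero    = p
read-≤ (p ∷ ps) (suc i) = read-≤ ps i

quotient-/ : ∀ m n .{{_ : NonZero n}} → quotient m n ≡ m / n
quotient-/ m (suc n) = ≡.refl

quotient-≤ : ∀ m n → quotient m n ≤ m
quotient-≤ m zero    = z≤n
quotient-≤ m (suc n) = m/n≤m m (suc n)

bits-≤ : ∀ {v m} → v ≤ 2 ^ m → bits v ≤ suc m
bits-≤ {v} {m} v≤ = s≤s (≤-trans (⌊log₂⌋-mono-≤ v≤) (≤-reflexive (⌊log₂[2^n]⌋≡n m)))

module _ {k : ℕ} where

  -- Bounds the bit length of a value in units of ℓ, and the number of subexpressions as well. A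
  -- literal c counts with `suc c` because c ≤ 2^c.
  weight : Exp k → ℕ
  weight (lit c)   = suc c
  weight (x [ e ]) = suc (weight e)
  weight (e ⊕ f)   = suc (weight e + weight f)
  weight (e ⊖ f)   = suc (weight e + weight f)
  weight (e ⊗ f)   = suc (weight e + weight f)
  weight (e ⊘ f)   = suc (weight e + weight f)

  module Bounded (ℓ : ℕ) (1≤ℓ : 1 ≤ ℓ) (K : ℕ) where

    -- Under this invariant the memory size, and the cost of any fixed expression, are polynomial in
    -- ℓ and `K`, whatever the memory contains.
    record Good (σ : Memory k) : Set where
      constructor good
      field
        lengths : ∀ x → length (lookup σ x) ≤ K
        values  : ∀ x → All (_≤ 2 ^ ℓ) (lookup σ x)
    open Good

    private
      2^-mono : ∀ {a b} → a ≤ b → 2 ^ a ≤ 2 ^ b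
      2^-mono = ^-monoʳ-≤ 2

    module _ {σ : Memory k} (g : Good σ) where

      private
        ℓ*suc : ∀ w → ℓ * suc w ≡ ℓ + ℓ * w
        ℓ*suc w = *-suc ℓ w

        grow : ∀ a b {u v} → u ≤ 2 ^ (ℓ * a) → v ≤ 2 ^ (ℓ * b) → u * v ≤ 2 ^ (ℓ * (a + b))
        grow a b p q = ≤-trans (*-mono-≤ p q) (≤-reflexive (≡.trans (≡.sym (^-distribˡ-+-* 2 (ℓ * a) (ℓ * b)))
          (cong (2 ^_) (≡.sym (*-distribˡ-+ ℓ a b)))))

        widen : ∀ {a b v} → a ≤ b → v ≤ 2 ^ (ℓ * a) → v ≤ 2 ^ (ℓ * b)
        widen a≤b p = ≤-trans p (2^-mono (*-monoʳ-≤ ℓ a≤b))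

      eval-≤ : ∀ e → eval σ e ≤ 2 ^ (ℓ * weight e)
      eval-≤ (lit c) = ≤-trans (n≤2^n c) (2^-mono (≤-trans (n≤1+n c)
        (≤-trans (≤-reflexive (≡.sym (*-identityˡ _))) (*-monoˡ-≤ (suc c) 1≤ℓ))))
      eval-≤ (x [ e ]) = ≤-trans (read-≤ (values g x) (eval σ e))
        (2^-mono (≤-trans (≤-reflexive (≡.sym (*-identityʳ ℓ))) (*-monoʳ-≤ ℓ (s≤s z≤n))))
      eval-≤ (e ⊕ f) = begin
        eval σ e + eval σ f
          ≤⟨ +-mono-≤ (widen (m≤m+n _ (weight f)) (eval-≤ e)) (widen (m≤n+m _ (weight e)) (eval-≤ f)) ⟩
        b + b                  ≡⟨ cong (b +_) (≡.sym (+-identityʳ b)) ⟩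
        2 * b                  ≤⟨ *-monoˡ-≤ b (2^-mono 1≤ℓ) ⟩
        2 ^ ℓ * b              ≡⟨ ^-distribˡ-+-* 2 ℓ (ℓ * w) ⟨
        2 ^ (ℓ + ℓ * w)        ≡⟨ cong (2 ^_) (ℓ*suc w) ⟨
        2 ^ (ℓ * suc w)        ∎
        where
        open ≤-Reasoning
        w = weight e + weight f
        b = 2 ^ (ℓ * w)
      eval-≤ (e ⊖ f) = ≤-trans (m∸n≤m _ (eval σ f)) (widen (≤-trans (m≤m+n _ (weight f)) (n≤1+n _)) (eval-≤ e))
      eval-≤ (e ⊗ f) = widen (n≤1+n _) (grow (weight e) (weight f) (eval-≤ e) (eval-≤ f))
      eval-≤ (e ⊘ f) = ≤-trans (quotient-≤ _ (eval σ f)) (widen (≤-trans (m≤m+n _ (weight f)) (n≤1+n _)) (eval-≤ e))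

      private
        bits-eval : ∀ e {w} → weight e ≤ w → bits (eval σ e) ≤ suc (ℓ * w)
        bits-eval e le = bits-≤ (widen le (eval-≤ e))

        -- The bound `w` on the values is kept apart from `weight e`, so that all subexpressions are
        -- charged the same amount and the charges add up.
        cost-≤′ : ∀ e {w} → weight e ≤ w → cost σ e ≤ weight e * suc (ℓ * w)
        binary : ∀ e f v {w} → suc (weight e + weight f) ≤ w → bits v ≤ suc (ℓ * w) →
          cost σ e + cost σ f + bits v ≤ suc (weight e + weight f) * suc (ℓ * w)

        binary e f v {w} le b≤ = begin
          cost σ e + cost σ f + bits v
            ≤⟨ +-mono-≤ (+-mono-≤ (cost-≤′ e (≤-trans (≤-trans (m≤m+n _ (weight f)) (n≤1+n _)) le))
                                  (cost-≤′ f (≤-trans (≤-trans (m≤n+m _ (weight e)) (n≤1+n _)) le))) b≤ ⟩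
          weight e * c + weight f * c + c ≡⟨ cong (_+ c) (*-distribʳ-+ c (weight e) (weight f)) ⟨
          (weight e + weight f) * c + c   ≡⟨ +-comm _ c ⟩
          suc (weight e + weight f) * c   ∎
          where
          open ≤-Reasoning
          c = suc (ℓ * w)

        cost-≤′ t@(lit c) {w} le = ≤-trans (bits-eval t le) (m≤m+n (suc (ℓ * w)) (c * suc (ℓ * w)))
        cost-≤′ t@(x [ e ]) {w} le = ≤-trans
          (+-mono-≤ (cost-≤′ e (≤-trans (n≤1+n _) le)) (bits-eval t le)) (≤-reflexive (+-comm _ (suc (ℓ * w))))
        cost-≤′ t@(e ⊕ f) le = binary e f (eval σ t) le (bits-eval t le)
        cost-≤′ t@(e ⊖ f) le = binary e f (eval σ t) le (bits-eval t le)
        cost-≤′ t@(e ⊗ f) le = binary e f (eval σ t) le (bits-eval t le)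
        cost-≤′ t@(e ⊘ f) le = binary e f (eval σ t) le (bits-eval t le)

      cost-≤ : ∀ e {w} → weight e ≤ w → cost σ e ≤ w * suc (ℓ * w)
      cost-≤ e {w} le = ≤-trans (cost-≤′ e le) (*-monoˡ-≤ (suc (ℓ * w)) le)

    size-≤ : ∀ {σ} → Good σ → size σ ≤ k * (K * suc ℓ)
    size-≤ {σ} g = arrays σ (lengths g) (values g)
      where
      array : ∀ {xs} → All (_≤ 2 ^ ℓ) xs → sum (map bits xs) ≤ length xs * suc ℓ
      array []       = z≤n
      array (p ∷ ps) = +-mono-≤ (bits-≤ p) (array ps)

      arrays : ∀ {j} (τ : Memory j) → (∀ x → length (lookup τ x) ≤ K) → (∀ x → All (_≤ 2 ^ ℓ) (lookup τ x)) →
        size τ ≤ j * (K * suc ℓ)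
      arrays []       _   _   = z≤n
      arrays (xs ∷ τ) len val = +-mono-≤ (≤-trans (array (val zero)) (*-monoˡ-≤ (suc ℓ) (len zero)))
        (arrays τ (len ∘ suc) (val ∘ suc))

    good-write : ∀ {σ} x {a v} → Good σ → a < K → v ≤ 2 ^ ℓ →
      Good (updateAt σ x (λ xs → write xs a v))
    good-write {σ} x {a} {v} g a<K v≤ = good
      (λ y → subst-at y (λ xs → length xs ≤ K) (λ xs → length-write xs a a<K) (lengths g))
      (λ y → subst-at y (All (_≤ 2 ^ ℓ)) (λ xs → All-write xs a) (values g))
      where
      length-write : ∀ xs a {K} → a < K → length xs ≤ K → length (write xs a v) ≤ K
      length-write []       zero    (s≤s _) _       = s≤s z≤n
      length-write []       (suc a) (s≤s p) _       = s≤s (length-write [] a p z≤n)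
      length-write (x ∷ xs) zero    _       q       = q
      length-write (x ∷ xs) (suc a) (s≤s p) (s≤s q) = s≤s (length-write xs a p q)

      All-write : ∀ xs a → All (_≤ 2 ^ ℓ) xs → All (_≤ 2 ^ ℓ) (write xs a v)
      All-write []       zero    []       = v≤ ∷ []
      All-write []       (suc a) []       = z≤n ∷ All-write [] a []
      All-write (x ∷ xs) zero    (p ∷ ps) = v≤ ∷ ps
      All-write (x ∷ xs) (suc a) (p ∷ ps) = p ∷ All-write xs a ps

      subst-at : ∀ y (P : List ℕ → Set) → (∀ xs → P xs → P (write xs a v)) → (∀ y → P (lookup σ y)) →
        P (lookup (updateAt σ x (λ xs → write xs a v)) y)
      subst-at y P w p with y Fin.≟ x
      ... | yes ≡.refl = subst P (≡.sym (lookup∘updateAt x σ)) (w _ (p x))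
      ... | no y≢x     = subst P (≡.sym (lookup∘updateAt′ y x y≢x σ)) (p y)

    -- A literal w lets the side conditions of the rules below be decided by
    -- evaluation.  The costs involve a separate bound E, which can stay a variable
    -- so that they are not normalised.
    module Steps (w E : ℕ) (w≤E : w ≤ E) where

      unit space : ℕ
      unit  = suc (E * suc (ℓ * E))
      space = k * (K * suc ℓ) + unit

      -- A total-correctness Hoare triple with a step count: each assignment and each test of a
      -- guard costs at most `unit`, and `space` bounds every moment of the run.
      record Run (P : Program k) (σ : Memory k) (steps : ℕ) (Post : Memory k → Set) : Set where
        constructor run
        field
          {σ′}  : Memory k
          {t s} : ℕ
          exec  : ⟨ P , σ ⟩⇓ σ′ ⟨ t , s ⟩
          t≤    : t ≤ steps * unit
          s≤    : s ≤ space
          good′ : Good σ′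
          post  : Post σ′

      private
        size≤space : ∀ {σ} → Good σ → size σ ≤ space
        size≤space g = ≤-trans (size-≤ g) (m≤m+n _ unit)

        eval-space : ∀ {σ c} → Good σ → c ≤ E * suc (ℓ * E) → size σ + c ≤ space
        eval-space g c≤ = +-mono-≤ (size-≤ g) (≤-trans c≤ (n≤1+n _))

      run-post : ∀ {P σ n Post Post′} → Run P σ n Post → (∀ {σ′} → Post σ′ → Post′ σ′) → Run P σ n Post′
      run-post (run ex t≤ s≤ g post) f = run ex t≤ s≤ g (f post)

      run-assign : ∀ {σ x a e Post} {_ : T (weight (a ⊕ e) ≤ᵇ w)} → Good σ →
        eval σ a < K → eval σ e ≤ 2 ^ ℓ →
        Post (updateAt σ x (λ xs → write xs (eval σ a) (eval σ e))) →
        Run (x [ a ]:= e) σ 1 Post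
      run-assign {σ} {x} {a} {e} {_} {small} g a<K v≤ post =
        run assign (≤-trans (s≤s c≤) (≤-reflexive (≡.sym (+-identityʳ unit))))
          (⊔-lub (eval-space g c≤) (size≤space g′)) g′ post
        where
        g′ = good-write x g a<K v≤
        c≤ : cost σ a + cost σ e ≤ E * suc (ℓ * E)
        -- The expression `a ⊕ e` never occurs in the program; its cost bounds the two costs
        -- together.
        c≤ = ≤-trans (m≤m+n _ (bits (eval σ (a ⊕ e)))) (cost-≤ g (a ⊕ e) {E} (≤-trans (≤ᵇ⇒≤ _ w small) w≤E))

      run-seq : ∀ {P Q σ m n Mid Post} → Run P σ m Mid →
        (∀ {σ′} → Good σ′ → Mid σ′ → Run Q σ′ n Post) → Run (P ⨾ Q) σ (m + n) Post
      run-seq {m = m} {n} (run ex t≤ s≤ g mid) next with next g mid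
      ... | run ex′ t≤′ s≤′ g′ post = run (seq ex ex′)
        (≤-trans (+-mono-≤ t≤ t≤′) (≤-reflexive (≡.sym (*-distribʳ-+ unit m n)))) (⊔-lub s≤ s≤′) g′ post

      run-assign⨾ : ∀ {σ x a e Q n Post} {_ : T (weight (a ⊕ e) ≤ᵇ w)} → Good σ →
        eval σ a < K → eval σ e ≤ 2 ^ ℓ →
        (let σ′ = updateAt σ x (λ xs → write xs (eval σ a) (eval σ e)) in Good σ′ → Run Q σ′ n Post) →
        Run (x [ a ]:= e ⨾ Q) σ (suc n) Post
      run-assign⨾ {σ} {x} {a} {e} {_} {_} {_} {small} g a<K v≤ next =
        run-seq {Mid = λ σ′ → σ′ ≡ updateAt σ x (λ xs → write xs (eval σ a) (eval σ e))}
          (run-assign {_} {x} {a} {e} {_} {small} g a<K v≤ ≡.refl) (λ { g′ ≡.refl → next g′ })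

      -- The invariant is indexed by the number of completed rounds. Each round pays for its body
      -- and one test of the guard; the last 1 is the failing test.
      run-while : ∀ {e P n} {_ : T (weight e ≤ᵇ w)} (Inv : ℕ → Memory k → Set) N →
        (∀ {i σ} → i < N → Good σ → Inv i σ → eval σ e ≢ 0 × Run P σ n (Inv (suc i))) →
        (∀ {σ} → Inv N σ → eval σ e ≡ 0) →
        ∀ {σ} → Good σ → Inv 0 σ → Run (while e repeat P) σ (N * suc n + 1) (Inv N)
      run-while {e} {P} {n} {small} Inv N body exit g inv = loop 0 N ≡.refl g inv
        where
        guard : ∀ {σ} → Good σ → cost σ e ≤ E * suc (ℓ * E)
        guard g = cost-≤ g e {E} (≤-trans (≤ᵇ⇒≤ _ w small) w≤E)

        loop : ∀ i d → i + d ≡ N → ∀ {σ} → Good σ → Inv i σ → Run (while e repeat P) σ (d * suc n + 1) (Inv N)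
        loop i zero eq g inv with ≡.trans (≡.sym (+-identityʳ i)) eq
        ... | ≡.refl = run (while-false (exit inv)) (≤-trans (s≤s (guard g)) (≤-reflexive (≡.sym (+-identityʳ unit))))
                         (eval-space g (guard g)) g inv
        loop i (suc d) eq {σ} g inv with body (subst (i <_) eq (m<m+n i (s≤s z≤n))) g inv
        ... | e≢0 , run {t = t₁} ex t≤ s≤ g₁ inv₁ with loop (suc i) d (≡.trans (≡.sym (+-suc i d)) eq) g₁ inv₁
        ... | run {t = t₂} ex′ t≤′ s≤′ g₂ inv₂ = run (while-true e≢0 ex ex′)
          (begin
            suc (cost σ e + (t₁ + t₂))                 ≤⟨ +-mono-≤ (s≤s (guard g)) (+-mono-≤ t≤ t≤′) ⟩
            unit + (n * unit + (d * suc n + 1) * unit) ≡⟨ +-assoc unit _ _ ⟨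
            suc n * unit + (d * suc n + 1) * unit      ≡⟨ *-distribʳ-+ unit (suc n) (d * suc n + 1) ⟨
            (suc n + (d * suc n + 1)) * unit           ≡⟨ cong (_* unit) (+-assoc (suc n) (d * suc n) 1) ⟨
            (suc d * suc n + 1) * unit                 ∎)
          (⊔-lub (eval-space g (guard g)) (⊔-lub s≤ s≤′)) g₂ inv₂
          where open ≤-Reasoning

-- The algorithm

pattern `n     = zero
pattern `table = suc zero
pattern `X     = suc (suc zero)
pattern `W     = suc (suc (suc zero))
pattern `L     = suc (suc (suc (suc zero)))
pattern `Z     = suc (suc (suc (suc (suc zero))))
pattern `T     = suc (suc (suc (suc (suc (suc zero)))))
pattern `g     = suc (suc (suc (suc (suc (suc (suc zero))))))
pattern `z     = suc (suc (suc (suc (suc (suc (suc (suc zero)))))))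
pattern `p     = suc (suc (suc (suc (suc (suc (suc (suc (suc zero))))))))
pattern `q     = suc (suc (suc (suc (suc (suc (suc (suc (suc (suc zero)))))))))

infix 5 _≔_
_≔_ : Fin 11 → Exp 11 → Program 11
x ≔ e = x [ lit 0 ]:= e

var : Fin 11 → Exp 11
var x = x [ lit 0 ]

infixl 7 _rem_
_rem_ : Exp 11 → Exp 11 → Exp 11
e rem f = e ⊖ e ⊘ f ⊗ f

half digit row column : Exp 11
half   = var `n ⊘ lit 2
digit  = var `z ⊖ var `z ⊘ lit 2 ⊗ lit 2
row    = var `q ⊘ var `n
column = var `q rem var `n

-- The table holds matrices B₀, B₁, … one after the other, each row by row.  B₀ is
-- the input, and Bₚ is the matrix when the first p pairs have been treated.
cell : Exp 11 → Exp 11 → Exp 11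
cell i j = `table [ var `p ⊗ (var `n ⊗ var `n) ⊕ (i ⊗ var `n ⊕ j) ]

cell-u cell-v : Exp 11 → Exp 11
cell-u = cell (lit 2 ⊗ var `p)
cell-v = cell (lit 1 ⊕ lit 2 ⊗ var `p)

-- Each leaf overwrites the matrices B₁, B₂, ... of the previous leaf and leaves B₀ intact, so the
-- table never grows beyond one branch. The counter `Z` names the leaf, and its copy `z` is consumed
-- digit by digit.
initialize powers-of-n modulus fill-matrix leaf-value sum-leaves main : Program 11

initialize =
  `X ≔ lit 1 ⨾ `W ≔ lit 1 ⨾ `L ≔ lit 1 ⨾ `Z ≔ lit 0 ⨾ `T ≔ lit 0 ⨾
  `g ≔ lit 0 ⨾ `z ≔ lit 0 ⨾ `p ≔ lit 0 ⨾ `q ≔ lit 0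

powers-of-n =
  while half ⊖ var `p repeat
    (`X ≔ (var `n ⊕ lit 2) ⊗ var `X ⨾ `L ≔ lit 2 ⊗ var `L ⨾ `p ≔ lit 1 ⊕ var `p)

modulus =
  while half ⊖ var `p repeat (`W ≔ var `X ⊗ var `W ⨾ `p ≔ lit 1 ⊕ var `p)

fill-matrix =
  while var `n ⊗ var `n ⊖ var `q repeat
    (`table [ (lit 1 ⊕ var `p) ⊗ (var `n ⊗ var `n) ⊕ var `q ]:=
       (cell row column ⊕ digit ⊗ (var `X ⊗ (cell-u row ⊗ cell-v column ⊕ cell-u column ⊗ cell-v row))) rem var `W ⨾
     `q ≔ lit 1 ⊕ var `q)

leaf-value =
  while half ⊖ var `p repeat
    (`g ≔ (var `g ⊗ (digit ⊗ (lit 1 ⊕ var `X ⊗ cell-u (lit 1 ⊕ lit 2 ⊗ var `p)) ⊕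
                      (lit 1 ⊖ digit) ⊗ (var `W ⊖ lit 1))) rem var `W ⨾
     `q ≔ lit 0 ⨾
     fill-matrix ⨾
     `z ≔ var `z ⊘ lit 2 ⨾
     `p ≔ lit 1 ⊕ var `p)

sum-leaves =
  while var `L ⊖ var `Z repeat
    (`z ≔ var `Z ⨾ `g ≔ lit 1 ⨾ `p ≔ lit 0 ⨾
     leaf-value ⨾
     `T ≔ (var `T ⊕ var `g) rem var `W ⨾
     `Z ≔ lit 1 ⊕ var `Z)

-- The last factor is 1 ∸ n % 2, since there is no perfect matching for odd n.
main =
  initialize ⨾
  powers-of-n ⨾ `X ≔ (var `n ⊕ lit 2) ⊗ var `X ⨾ `p ≔ lit 0 ⨾
  modulus ⨾ `W ≔ var `X ⊗ var `W ⨾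
  sum-leaves ⨾
  `n ≔ var `T ⊘ (var `W ⊘ var `X) ⊗ (lit 1 ⊖ (var `n ⊖ half ⊗ lit 2))

-- Verification of the program

modulo : ℕ → ℕ → ℕ
modulo v w = v ∸ quotient v w * w

modulo-% : ∀ v w .{{_ : NonZero w}} → modulo v w ≡ v % w
modulo-% v w = ≡.trans (cong (λ t → v ∸ t * w) (quotient-/ v w)) (≡.sym (m%n≡m∸m/n*n v w))

module _ {n i j : ℕ} (j<n : j < n) where
  private
    instance
      n≢0 : NonZero n
      n≢0 = >-nonZero (≤-trans (s≤s z≤n) j<n)

  quotient-index : quotient (i * n + j) n ≡ i
  quotient-index = begin
    quotient (i * n + j) n ≡⟨ quotient-/ (i * n + j) n ⟩
    (i * n + j) / n        ≡⟨ +-distrib-/-∣ˡ j (divides i ≡.refl) ⟩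
    i * n / n + j / n      ≡⟨ cong₂ _+_ (m*n/n≡m i n) (m<n⇒m/n≡0 j<n) ⟩
    i + 0                  ≡⟨ +-identityʳ i ⟩
    i                      ∎
    where
    open ≡-Reasoning

  modulo-index : modulo (i * n + j) n ≡ j
  modulo-index = ≡.trans (cong (λ t → i * n + j ∸ t * n) quotient-index) (m+n∸m≡n (i * n) j)

index< : ∀ {n i j} → i < n → j < n → i * n + j < n * n
index< {n} {i} {j} i<n j<n = begin-strict
  i * n + j  <⟨ +-monoʳ-< (i * n) j<n ⟩
  i * n + n  ≡⟨ +-comm (i * n) n ⟩
  suc i * n  ≤⟨ *-monoˡ-≤ n i<n ⟩
  n * n      ∎
  where open ≤-Reasoning

-- `X` and `W` are variables tied to their powers only by `X≡` and `W≡`, so the invariants do not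
-- unfold them. The constant 600 exceeds the `weight` of every guard and assignment of `main`.
module Verification (n ℓ : ℕ) (1≤ℓ : 1 ≤ ℓ)
  (X W : ℕ) .{{_ : NonZero X}} .{{_ : NonZero W}}
  (X≡ : (n + 2) * (n + 2) ^ (n / 2) ≡ X) (W≡ : X * X ^ (n / 2) ≡ W)
  (n≤ : suc (n * n) ≤ 2 ^ ℓ) (W≤ : W ≤ 2 ^ ℓ) (2^m≤ : suc (2 ^ (n / 2)) ≤ 2 ^ ℓ)
  (E : ℕ) (600≤E : 600 ≤ E) (adj : List ℕ) where

  private
    m : ℕ
    m = n / 2

  -- Room for the m + 1 matrices of one branch; the extra cell keeps address 0 legal when `n` is 0.
  K : ℕ
  K = suc (suc m * (n * n))

  open Bounded {11} ℓ 1≤ℓ K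
  open Steps 600 E 600≤E
  open Modular W X

  level : List ℕ → ℕ → ℕ → ℕ → ℕ
  level tbl p i j = read tbl (p * (n * n) + (i * n + j))

  state : List ℕ → (X W L Z T g z p q : ℕ) → Memory 11
  state tbl X W L Z T g z p q =
    (n ∷ []) ∷ tbl ∷ (X ∷ []) ∷ (W ∷ []) ∷ (L ∷ []) ∷ (Z ∷ []) ∷ (T ∷ []) ∷
    (g ∷ []) ∷ (z ∷ []) ∷ (p ∷ []) ∷ (q ∷ []) ∷ []

  private
    0<K : 0 < K
    0<K = s≤s z≤n

    2m≤n : 2 * m ≤ n
    2m≤n = ≤-trans (≤-reflexive (*-comm 2 m)) (m/n*n≤m n 2)

    m≤n : m ≤ n
    m≤n = m/n≤m n 2

    sm≤ : suc m ≤ 2 ^ ℓ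
    sm≤ = ≤-trans (s≤s (≤-trans m≤n (n≤n*n n))) n≤

    modulo< : ∀ v → modulo v W < W
    modulo< v = subst (_< W) (≡.sym (modulo-% v W)) (m%n<n v W)

    modulo≤ : ∀ v → modulo v W ≤ 2 ^ ℓ
    modulo≤ v = ≤-trans (<⇒≤ (modulo< v)) W≤

    modulo-≈ : ∀ v → modulo v W ≈ v
    modulo-≈ v = trans (≡⇒≈ (modulo-% v W)) (mod (m%n%n≡m%n v W))

  module _ {L Z T g z p : ℕ} (p<m : p < m) (tbl : List ℕ) where
    private
      entry : List ℕ → ℕ → ℕ
      entry tbl q = modulo (next (lowBit z) p (level tbl p) (quotient q n) (modulo q n)) W

      -- New entries are described through the table `tbl` from before the loop, although the
      -- program reads the current one. The first clause, that levels up to `p` are untouched, makes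
      -- this legitimate by `entry-≡`.
      Inv : ℕ → Memory 11 → Set
      Inv k σ = ∃[ tbl′ ] σ ≡ state tbl′ X W L Z T g z p k
        × (∀ a → a < suc p * (n * n) → read tbl′ a ≡ read tbl a)
        × (∀ q → q < k → read tbl′ (suc p * (n * n) + q) ≡ entry tbl q)

      v<n : suc (2 * p) < n
      v<n = ≤-trans (≤-trans (≤-reflexive (≡.sym (*-suc 2 p))) (*-monoʳ-≤ 2 p<m)) 2m≤n

      u<n : 2 * p < n
      u<n = <-trans (n<1+n _) v<n

      level-≡ : ∀ {tbl′} → (∀ a → a < suc p * (n * n) → read tbl′ a ≡ read tbl a) →
        ∀ {i j} → i < n → j < n → level tbl′ p i j ≡ level tbl p i j
      level-≡ same i<n j<n = same _ (≤-trans (+-monoʳ-< (p * (n * n)) (index< i<n j<n))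
        (≤-reflexive (+-comm (p * (n * n)) (n * n))))

      entry-≡ : ∀ {tbl′} → (∀ a → a < suc p * (n * n) → read tbl′ a ≡ read tbl a) →
        ∀ {q} → q < n * n → entry tbl′ q ≡ entry tbl q
      entry-≡ {tbl′} same {q} q<nn = cong (λ v → modulo v W) (cong₂ (λ a b → a + lowBit z * (X * b))
        (level-≡ {tbl′} same i<n j<n)
        (cong₂ _+_ (cong₂ _*_ (level-≡ {tbl′} same u<n i<n) (level-≡ {tbl′} same v<n j<n))
                   (cong₂ _*_ (level-≡ {tbl′} same u<n j<n) (level-≡ {tbl′} same v<n i<n))))
        where
        instance
          n≢0 : NonZero n
          n≢0 = >-nonZero (≤-trans (s≤s z≤n) u<n)
        i<n : quotient q n < n
        i<n = subst (_< n) (≡.sym (quotient-/ q n)) (m<n*o⇒m/o<n q<nn)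
        j<n : modulo q n < n
        j<n = subst (_< n) (≡.sym (modulo-% q n)) (m%n<n q n)

      target< : ∀ {q} → q < n * n → suc p * (n * n) + q < K
      target< {q} q<nn = s≤s (≤-trans (<⇒≤ (+-monoʳ-< (suc p * (n * n)) q<nn))
        (≤-trans (≤-reflexive (+-comm _ (n * n))) (*-monoˡ-≤ (n * n) (s≤s p<m))))

    run-fill-matrix : Good (state tbl X W L Z T g z p 0) →
      Run fill-matrix (state tbl X W L Z T g z p 0) (n * n * 3 + 1) λ σ →
        ∃[ tbl′ ] σ ≡ state tbl′ X W L Z T g z p (n * n)
        × (∀ a → a < n * n → read tbl′ a ≡ read tbl a)
        × (∀ i j → i < n → j < n → level tbl′ (suc p) i j ≈ next (lowBit z) p (level tbl p) i j)
    run-fill-matrix gd = run-post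
      (run-while Inv (n * n) body (λ { (_ , ≡.refl , _) → n∸n≡0 (n * n) }) gd
        (tbl , ≡.refl , (λ _ _ → ≡.refl) , (λ _ ())))
      (λ { (tbl′ , eq , same , new) → tbl′ , eq ,
        (λ a a<nn → same a (≤-trans a<nn (m≤m+n (n * n) (p * (n * n))))) ,
        (λ i j i<n j<n → trans (≡⇒≈ (new (i * n + j) (index< i<n j<n)))
          (trans (modulo-≈ _) (≡⇒≈ (cong₂ (next (lowBit z) p (level tbl p))
            (quotient-index j<n) (modulo-index {n} {i} j<n))))) })
      where
      body : ∀ {q σ} → q < n * n → Good σ → Inv q σ →
        eval σ (var `n ⊗ var `n ⊖ var `q) ≢ 0 × Run _ σ 2 (Inv (suc q))
      body {q} q<nn gd (tbl′ , ≡.refl , same , new) = m>n⇒m∸n≢0 q<nn ,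
        run-assign⨾ gd (target< q<nn) (modulo≤ _) λ gd →
        run-assign gd 0<K (≤-trans (≤-trans q<nn (n≤1+n _)) n≤)
          ( write tbl′ (suc p * (n * n) + q) (entry tbl′ q) , ≡.refl
          , (λ a a< → ≡.trans (read-write-≢ tbl′ _ _ a (<⇒≢ (≤-trans a< (m≤m+n _ q)))) (same a a<))
          , λ q′ q′≤q →
              [ (λ q′<q → ≡.trans (read-write-≢ tbl′ _ _ _ (<⇒≢ (+-monoʳ-< (suc p * (n * n)) q′<q))) (new q′ q′<q))
              , (λ { ≡.refl → ≡.trans (read-write tbl′ _ _) (entry-≡ {tbl′} same q<nn) })
              ]′ (m≤n⇒m<n∨m≡n (≤-pred q′≤q)))

  A : ℕ → ℕ → ℕ
  A = level adj 0

  HoldsInput : List ℕ → Set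
  HoldsInput tbl = ∀ a → a < n * n → read tbl a ≡ read adj a

  leafSteps : ℕ
  leafSteps = m * suc (1 + (1 + ((n * n * 3 + 1) + 2))) + 1

  run-leaf-value : ∀ {L Z T q} tbl → Z ≤ 2 ^ ℓ → HoldsInput tbl → Good (state tbl X W L Z T 1 Z 0 q) →
    Run leaf-value (state tbl X W L Z T 1 Z 0 q) leafSteps λ σ →
      ∃[ tbl′ ] ∃[ g ] ∃[ z ] ∃[ q′ ] σ ≡ state tbl′ X W L Z T g z m q′
      × HoldsInput tbl′ × g ≤ 2 ^ ℓ × g ≈ leaf m 0 Z A
  run-leaf-value {L} {Z} {T} {q} tbl Z≤ inp gd = run-post
    (run-while Inv m body (λ { (_ , _ , _ , _ , _ , ≡.refl , _) → n∸n≡0 m }) gd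
      (tbl , 1 , Z , q , m , ≡.refl , ≡.refl , inp , ≤-trans (s≤s z≤n) n≤ , ≤-refl , start))
    (λ { (tbl′ , g , z , q′ , d , eq , m+d≡m , inp′ , g≤ , z≤ , g≈) →
      tbl′ , g , z , q′ , eq , inp′ , g≤ , finish g z (level tbl′ m) d m+d≡m g≈ })
    where
    -- The product so far times the leaf value of the `d` untreated pairs is constant modulo `W`. At
    -- the end `d` is 0 and the second factor is 1.
    Inv : ℕ → Memory 11 → Set
    Inv p σ = ∃[ tbl′ ] ∃[ g ] ∃[ z ] ∃[ q′ ] ∃[ d ] σ ≡ state tbl′ X W L Z T g z p q′ × p + d ≡ m
      × HoldsInput tbl′ × g ≤ 2 ^ ℓ × z ≤ Z × g * leaf d p z (level tbl′ p) ≈ leaf m 0 Z A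

    start : 1 * leaf m 0 Z (level tbl 0) ≈ leaf m 0 Z A
    start = trans (≡⇒≈ (*-identityˡ _)) (leaf-cong n m 0 Z 2m≤n (λ i j i<n j<n → ≡⇒≈ (inp _ (index< i<n j<n))))

    finish : ∀ g z B d → m + d ≡ m → g * leaf d m z B ≈ leaf m 0 Z A → g ≈ leaf m 0 Z A
    finish g z B d eq g≈ with m+n≡m⇒n≡0 {m} {d} eq
      where
      m+n≡m⇒n≡0 : ∀ {m n} → m + n ≡ m → n ≡ 0
      m+n≡m⇒n≡0 {m} {n} eq = +-cancelˡ-≡ m n 0 (≡.trans eq (≡.sym (+-identityʳ m)))
    ... | ≡.refl = trans (≡⇒≈ (≡.sym (*-identityʳ g))) g≈

    body : ∀ {p σ} → p < m → Good σ → Inv p σ → eval σ (half ⊖ var `p) ≢ 0 × Run _ σ _ (Inv (suc p))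
    body {p} p<m gd (tbl , g , z , q , zero , ≡.refl , p≡m , inp , g≤ , z≤ , g≈) =
      contradiction (≡.trans (≡.sym (+-identityʳ p)) p≡m) (<⇒≢ p<m)
    body {p} p<m gd (tbl , g , z , q , suc d , ≡.refl , p+d≡m , inp , g≤ , z≤ , g≈) = m>n⇒m∸n≢0 p<m ,
      run-assign⨾ gd 0<K (modulo≤ _) λ gd →
      run-assign⨾ gd 0<K z≤n λ gd →
      run-seq (run-fill-matrix p<m tbl gd) λ { gd (tbl′ , ≡.refl , same , lev) →
      run-assign⨾ gd 0<K (≤-trans (m/n≤m z 2) (≤-trans z≤ Z≤)) λ gd →
      run-assign gd 0<K (≤-trans (s≤s (<⇒≤ p<m)) sm≤)
        ( tbl′ , _ , _ , _ , d , ≡.refl , ≡.trans (≡.sym (+-suc p d)) p+d≡m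
        , (λ a a< → ≡.trans (same a a<) (inp a a<)) , modulo≤ _ , ≤-trans (m/n≤m z 2) z≤
        , trans (*-cong (modulo-≈ (g * f)) (leaf-cong n d (suc p) (z / 2) bound lev))
            (trans (≡⇒≈ (*-assoc g f _)) g≈)) }
      where
      f = factor (lowBit z) (level tbl p (2 * p) (suc (2 * p)))
      bound : 2 * (suc p + d) ≤ n
      bound = subst (λ k → 2 * k ≤ n) (≡.trans (≡.sym p+d≡m) (+-suc p d)) 2m≤n

  sumSteps : ℕ
  sumSteps = 2 ^ m * suc (3 + (leafSteps + 2)) + 1

  run-sum-leaves : Good (state adj X W (2 ^ m) 0 0 0 0 m 0) → 
    Run sum-leaves (state adj X W (2 ^ m) 0 0 0 0 m 0) sumSteps λ σ →
      ∃[ tbl ] ∃[ T ] ∃[ g ] ∃[ z ] ∃[ p ] ∃[ q ] σ ≡ state tbl X W (2 ^ m) (2 ^ m) T g z p q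
      × T < W × T ≈ ∑ (2 ^ m) (λ z → leaf m 0 z A)
  run-sum-leaves gd = run-post
    (run-while Inv (2 ^ m) body (λ { (_ , _ , _ , _ , _ , _ , ≡.refl , _) → n∸n≡0 (2 ^ m) }) gd
      (adj , 0 , 0 , 0 , m , 0 , ≡.refl , (λ _ _ → ≡.refl) , >-nonZero⁻¹ W , refl))
    (λ { (tbl , T , g , z , p , q , eq , _ , T<W , T≈) → tbl , T , g , z , p , q , eq , T<W , T≈ })
    where
    -- T < W is carried along because the final recovery needs the remainder itself and not only its
    -- residue class.
    Inv : ℕ → Memory 11 → Set
    Inv Z σ = ∃[ tbl ] ∃[ T ] ∃[ g ] ∃[ z ] ∃[ p ] ∃[ q ] σ ≡ state tbl X W (2 ^ m) Z T g z p q
      × HoldsInput tbl × T < W × T ≈ ∑ Z (λ z → leaf m 0 z A)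

    body : ∀ {Z σ} → Z < 2 ^ m → Good σ → Inv Z σ →
      eval σ (var `L ⊖ var `Z) ≢ 0 × Run _ σ _ (Inv (suc Z))
    body {Z} Z< gd (tbl , T , g , z , p , q , ≡.refl , inp , T<W , T≈) = m>n⇒m∸n≢0 Z< ,
      run-assign⨾ gd 0<K Z≤ λ gd →
      run-assign⨾ gd 0<K (≤-trans (s≤s z≤n) n≤) λ gd →
      run-assign⨾ gd 0<K z≤n λ gd →
      run-seq (run-leaf-value tbl Z≤ inp gd) λ { gd (tbl′ , g , _ , _ , ≡.refl , inp′ , _ , g≈) →
      run-assign⨾ gd 0<K (modulo≤ _) λ gd →
      run-assign gd 0<K (≤-trans (s≤s (<⇒≤ Z<)) 2^m≤)
        ( tbl′ , _ , _ , _ , _ , _ , ≡.refl , inp′ , modulo< _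
        , trans (modulo-≈ (T + g)) (+-cong T≈ g≈)) }
      where
      Z≤ : Z ≤ 2 ^ ℓ
      Z≤ = ≤-trans (<⇒≤ Z<) (≤-trans (n≤1+n _) 2^m≤)

  private
    X≤W : X ≤ W
    X≤W = subst (X ≤_) W≡ (≤-trans (≤-reflexive (≡.sym (*-identityʳ X))) (*-monoʳ-≤ X (m^n>0 X m)))

    n+2≢0 : NonZero (n + 2)
    n+2≢0 = >-nonZero (≤-trans (s≤s z≤n) (m≤n+m 2 n))

    ^-≤ : ∀ b .{{_ : NonZero b}} {i} → i ≤ m → b ^ i ≤ b * b ^ m
    ^-≤ b i≤m = ≤-trans (^-monoʳ-≤ b i≤m) (m≤n*m (b ^ m) b)

  run-powers-of-n : Good (state adj 1 1 1 0 0 0 0 0 0) →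
    Run powers-of-n (state adj 1 1 1 0 0 0 0 0 0) (m * 4 + 1)
      (_≡ state adj ((n + 2) ^ m) 1 (2 ^ m) 0 0 0 0 m 0)
  run-powers-of-n gd = run-while (λ i → _≡ state adj ((n + 2) ^ i) 1 (2 ^ i) 0 0 0 0 i 0) m
    (λ { i<m gd ≡.refl → m>n⇒m∸n≢0 i<m ,
      run-assign⨾ gd 0<K (≤-trans (^-≤ (n + 2) {{n+2≢0}} i<m) (≤-trans (≤-reflexive X≡) (≤-trans X≤W W≤))) λ gd →
      run-assign⨾ gd 0<K (≤-trans (^-monoʳ-≤ 2 i<m) (≤-trans (n≤1+n _) 2^m≤)) λ gd →
      run-assign gd 0<K (≤-trans (≤-trans i<m (n≤1+n _)) sm≤) ≡.refl })
    (λ { ≡.refl → n∸n≡0 m }) gd ≡.refl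

  run-modulus : Good (state adj X 1 (2 ^ m) 0 0 0 0 0 0) →
    Run modulus (state adj X 1 (2 ^ m) 0 0 0 0 0 0) (m * 3 + 1)
      (_≡ state adj X (X ^ m) (2 ^ m) 0 0 0 0 m 0)
  run-modulus gd = run-while (λ i → _≡ state adj X (X ^ i) (2 ^ m) 0 0 0 0 i 0) m
    (λ { i<m gd ≡.refl → m>n⇒m∸n≢0 i<m ,
      run-assign⨾ gd 0<K (≤-trans (^-≤ X i<m) (≤-trans (≤-reflexive W≡) W≤)) λ gd →
      run-assign gd 0<K (≤-trans (≤-trans i<m (n≤1+n _)) sm≤) ≡.refl })
    (λ { ≡.refl → n∸n≡0 m }) gd ≡.refl

  start : Memory 11
  start = (n ∷ []) ∷ adj ∷ [] ∷ [] ∷ [] ∷ [] ∷ [] ∷ [] ∷ [] ∷ [] ∷ [] ∷ []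

  mainSteps : ℕ
  mainSteps = 9 + ((m * 4 + 1) + (2 + ((m * 3 + 1) + (1 + (sumSteps + 1)))))

  Result : Memory 11 → Set
  Result σ = ∃[ T ] output σ ≡ quotient T (quotient W X) * (1 ∸ (n ∸ m * 2))
    × T < W × T ≈ ∑ (2 ^ m) (λ z → leaf m 0 z A)

  run-main : Good start → Run main start mainSteps Result
  run-main gd = 
    run-seq {m = 9}
      (run-assign⨾ gd 0<K 1≤ λ gd → run-assign⨾ gd 0<K 1≤ λ gd → run-assign⨾ gd 0<K 1≤ λ gd →
       run-assign⨾ gd 0<K z≤n λ gd → run-assign⨾ gd 0<K z≤n λ gd → run-assign⨾ gd 0<K z≤n λ gd →
       run-assign⨾ gd 0<K z≤n λ gd → run-assign⨾ gd 0<K z≤n λ gd →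
       run-assign {Post = _≡ state adj 1 1 1 0 0 0 0 0 0} gd 0<K z≤n ≡.refl) λ { gd ≡.refl →
    run-seq (run-powers-of-n gd) λ { gd ≡.refl →
    run-assign⨾ gd 0<K (≤-trans (≤-reflexive X≡) (≤-trans X≤W W≤)) λ gd →
    run-assign⨾ gd 0<K z≤n λ gd →
    run-rest gd } }
    where
    1≤ : 1 ≤ 2 ^ ℓ
    1≤ = ≤-trans (s≤s z≤n) n≤

    final : ∀ {T} → T < W → quotient T (quotient W X) * (1 ∸ (n ∸ m * 2)) ≤ 2 ^ ℓ
    final {T} T<W = ≤-trans (*-mono-≤ (quotient-≤ T (quotient W X)) (m∸n≤m 1 (n ∸ m * 2)))
      (≤-trans (≤-reflexive (*-identityʳ T)) (≤-trans (<⇒≤ T<W) W≤))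

    rest : Program 11
    rest = modulus ⨾ `W ≔ var `X ⊗ var `W ⨾ sum-leaves ⨾
      `n ≔ var `T ⊘ (var `W ⊘ var `X) ⊗ (lit 1 ⊖ (var `n ⊖ half ⊗ lit 2))

    run-rest : Good (state adj ((n + 2) * (n + 2) ^ m) 1 (2 ^ m) 0 0 0 0 0 0) →
      Run rest (state adj ((n + 2) * (n + 2) ^ m) 1 (2 ^ m) 0 0 0 0 0 0) ((m * 3 + 1) + (1 + (sumSteps + 1))) Result
    -- The memory now holds the computed power; `X≡` renames it to `X`, in which the following
    -- invariants are stated. `W≡` does the same below.
    run-rest gd = subst
      (λ x → Run rest (state adj x 1 (2 ^ m) 0 0 0 0 0 0) ((m * 3 + 1) + (1 + (sumSteps + 1))) Result) (≡.sym X≡)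
      (run-seq (run-modulus (subst (λ x → Good (state adj x 1 (2 ^ m) 0 0 0 0 0 0)) X≡ gd)) λ { gd ≡.refl →
       run-assign⨾ gd 0<K (≤-trans (≤-reflexive W≡) W≤) λ gd →
       subst (λ w → Run tail (state adj X w (2 ^ m) 0 0 0 0 m 0) (sumSteps + 1) Result) (≡.sym W≡)
         (run-tail (subst (λ w → Good (state adj X w (2 ^ m) 0 0 0 0 m 0)) W≡ gd)) })
      where
      tail : Program 11
      tail = sum-leaves ⨾ `n ≔ var `T ⊘ (var `W ⊘ var `X) ⊗ (lit 1 ⊖ (var `n ⊖ half ⊗ lit 2))

      run-tail : Good (state adj X W (2 ^ m) 0 0 0 0 m 0) →
        Run tail (state adj X W (2 ^ m) 0 0 0 0 m 0) (sumSteps + 1) Result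
      run-tail gd = run-seq (run-sum-leaves gd) λ { gd (tbl , T , _ , _ , _ , _ , ≡.refl , T<W , T≈) →
        run-assign gd 0<K (final T<W) (T , ≡.refl , T<W , T≈) }

-- Polynomial bounds

infixl 6 _∔_
infixl 7 _∙_

_∔_ _∙_ : Polynomial → Polynomial → Polynomial
[]      ∔ q       = q
(a ∷ p) ∔ []      = a ∷ p
(a ∷ p) ∔ (b ∷ q) = a + b ∷ p ∔ q
[]      ∙ q = []
(a ∷ p) ∙ q = map (a *_) q ∔ (0 ∷ p ∙ q)

constant : ℕ → Polynomial
constant c = c ∷ []

𝕩 : Polynomial
𝕩 = 0 ∷ 1 ∷ []

module _ (x : ℕ) where
  open +-*-Solver

  at-∔ : ∀ p q → (p ∔ q) at x ≡ p at x + q at x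
  at-∔ []      q       = ≡.refl
  at-∔ (a ∷ p) []      = ≡.sym (+-identityʳ _)
  at-∔ (a ∷ p) (b ∷ q) = ≡.trans (cong (λ r → a + b + x * r) (at-∔ p q))
    (solve 5 (λ x a b p q → a :+ b :+ x :* (p :+ q) := a :+ x :* p :+ (b :+ x :* q)) ≡.refl x a b (p at x) (q at x))

  at-map : ∀ c q → map (c *_) q at x ≡ c * q at x
  at-map c []      = ≡.sym (*-zeroʳ c)
  at-map c (a ∷ q) = ≡.trans (cong (λ r → c * a + x * r) (at-map c q))
    (solve 4 (λ x c a q → c :* a :+ x :* (c :* q) := c :* (a :+ x :* q)) ≡.refl x c a (q at x))

  at-∙ : ∀ p q → (p ∙ q) at x ≡ p at x * q at x
  at-∙ []      q = ≡.refl
  at-∙ (a ∷ p) q = ≡.trans (at-∔ (map (a *_) q) (0 ∷ p ∙ q))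
    (≡.trans (cong₂ (λ s r → s + x * r) (at-map a q) (at-∙ p q))
    (solve 4 (λ x a p q → a :* q :+ x :* (p :* q) := (a :+ x :* p) :* q) ≡.refl x a (p at x) (q at x)))

module Evaluation (x : ℕ) where

  infix 4 _≼_
  record _≼_ (a : ℕ) (p : Polynomial) : Set where
    constructor bound
    field ≤at : a ≤ p at x
  open _≼_ public

  infixl 6 _≼∔_
  infixl 7 _≼∙_

  _≼∔_ : ∀ {a b p q} → a ≼ p → b ≼ q → a + b ≼ p ∔ q
  _≼∔_ {p = p} {q} (bound a≤) (bound b≤) = bound (≤-trans (+-mono-≤ a≤ b≤) (≤-reflexive (≡.sym (at-∔ x p q))))

  _≼∙_ : ∀ {a b p q} → a ≼ p → b ≼ q → a * b ≼ p ∙ q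
  _≼∙_ {p = p} {q} (bound a≤) (bound b≤) = bound (≤-trans (*-mono-≤ a≤ b≤) (≤-reflexive (≡.sym (at-∙ x p q))))

  ≼constant : ∀ c → c ≼ constant c
  ≼constant c = bound (m≤m+n c _)

  ≼𝕩 : ∀ {a} → a ≤ x → a ≼ 𝕩
  ≼𝕩 a≤x = bound (≤-trans a≤x (≤-reflexive (solve 1 (λ x → x := x :* (con 1 :+ x :* con 0)) ≡.refl x)))
    where open +-*-Solver

module _ {n : ℕ} where

  -- Repeats the local definitions inside `input`, with which `entries` agrees by computation.
  bit : Bool → ℕ
  bit b = Bool.if b then 1 else 0

  entries : Matrix n → List ℕ
  entries M = Vec.toList (Vec.map bit (Vec.concat M))

  private
    read-toList : ∀ {k} (v : Vec ℕ k) i → read (Vec.toList v) (toℕ i) ≡ lookup v i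
    read-toList (x ∷ v) zero    = ≡.refl
    read-toList (x ∷ v) (suc i) = read-toList v i

    lookup-∈? : ∀ {k} (s : Subset k) i → lookup s i ≡ does (i ∈? s)
    lookup-∈? s i with i ∈? s | lookup s i in eq
    ... | yes _   | true  = ≡.refl
    ... | no _    | false = ≡.refl
    ... | yes i∈s | false = contradiction (≡.trans (≡.sym ([]=⇒lookup i∈s)) eq) λ ()
    ... | no i∉s  | true  = contradiction (lookup⇒[]= i s eq) i∉s

  length-entries : ∀ M → length (entries M) ≡ n * n
  length-entries M = length-toList (Vec.map bit (Vec.concat M))

  entries≤1 : ∀ M → All (_≤ 1) (entries M)
  entries≤1 M = go (Vec.concat M)
    where
    bit≤1 : ∀ b → bit b ≤ 1
    bit≤1 true  = ≤-refl
    bit≤1 false = z≤n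
    go : ∀ {k} (v : Vec Bool k) → All (_≤ 1) (Vec.toList (Vec.map bit v))
    go []      = []
    go (b ∷ v) = bit≤1 b ∷ go v

  read-entries : ∀ M (i j : Fin n) →
    read (entries M) (toℕ i * n + toℕ j) ≡ (Bool.if does (adj? M i j) then 1 else 0)
  read-entries M i j = begin
    read (entries M) (toℕ i * n + toℕ j)         ≡⟨ cong (λ a → read (entries M) (a + toℕ j)) (*-comm (toℕ i) n) ⟩
    read (entries M) (n * toℕ i + toℕ j)         ≡⟨ cong (read (entries M)) (Fin.toℕ-combine i j) ⟨
    read (entries M) (toℕ (Fin.combine i j))     ≡⟨ read-toList (Vec.map bit (Vec.concat M)) (Fin.combine i j) ⟩
    lookup (Vec.map bit (Vec.concat M)) (Fin.combine i j) ≡⟨ lookup-map (Fin.combine i j) bit (Vec.concat M) ⟩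
    bit (lookup (Vec.concat M) (Fin.combine i j)) ≡⟨ cong bit (lookup-concat M i j) ⟩
    bit (lookup (lookup M i) j)                  ≡⟨ cong bit (lookup-∈? (lookup M i) j) ⟩
    bit (does (adj? M i j))                      ∎
    where open ≡-Reasoning

pairs-tabulate : ∀ {k} m p (f : Fin k → ℕ) → k ≡ 2 * m → (∀ i → f i ≡ 2 * p + toℕ i) →
  pairs p m ≡ List.tabulate f
pairs-tabulate {zero}        zero    p f eq f≡ = ≡.refl
pairs-tabulate {suc (suc k)} (suc m) p f eq f≡ = cong₂ _∷_
  (≡.sym (≡.trans (f≡ zero) (+-identityʳ (2 * p))))
  (cong₂ _∷_ (≡.sym (≡.trans (f≡ (suc zero)) (+-comm (2 * p) 1)))
    (pairs-tabulate m (suc p) (λ i → f (suc (suc i)))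
      (suc-injective (suc-injective (≡.trans eq (*-suc 2 m))))
      (λ i → ≡.trans (f≡ (suc (suc i)))
        (solve 2 (λ p i → con 2 :* p :+ (con 2 :+ i) := con 2 :* (con 1 :+ p) :+ i) ≡.refl p (toℕ i)))))
  where open +-*-Solver
pairs-tabulate {suc zero}    (suc m) p f eq f≡ = contradiction (≡.trans eq (*-suc 2 m)) λ ()

length-pairs : ∀ p m → length (pairs p m) ≡ 2 * m
length-pairs p zero    = ≡.refl
length-pairs p (suc m) = ≡.trans (cong (2 +_) (length-pairs (suc p) m)) (≡.sym (*-suc 2 m))

-- Choice of the modulus and of the bit bound

module Parameters (n : ℕ) where

  private
    m b : ℕ
    m = n / 2
    b = n + 2

    m≤n : m ≤ n
    m≤n = m/n≤m n 2

    sm≤b : suc m ≤ b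
    sm≤b = ≤-trans (s≤s m≤n) (≤-trans (n≤1+n _) (≤-reflexive (+-comm 2 n)))

  -- The hafnian is at most n^m, where m = n / 2, so X = (n + 2)^(m + 1) exceeds it; a base of at
  -- least 2 makes this strict even for n = 0. As n + 2 ≤ 2^(n + 2), the modulus W = (n + 2)^((m +
  -- 1)²) has at most about (n + 2)³ bits, whence ℓ.
  ℓ X W : ℕ
  ℓ = (n + 2) * ((n + 2) * (n + 2))
  X = (n + 2) ^ suc (n / 2)
  W = X ^ suc (n / 2)

  instance
    b≢0 : NonZero b
    b≢0 = >-nonZero (≤-trans (s≤s z≤n) (m≤n+m 2 n))

    X≢0 : NonZero X
    X≢0 = m^n≢0 b (suc m)

    W≢0 : NonZero W
    W≢0 = m^n≢0 X (suc m)

  b≤ℓ : b ≤ ℓ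
  b≤ℓ = m≤m*n b (b * b) {{m*n≢0 b b}}

  1≤ℓ : 1 ≤ ℓ
  1≤ℓ = ≤-trans (≤-trans (s≤s z≤n) (m≤n+m 2 n)) b≤ℓ

  suc[n*n]≤2^ℓ : suc (n * n) ≤ 2 ^ ℓ
  suc[n*n]≤2^ℓ = ≤-trans (≤-trans nn< (m≤n*m (b * b) b)) (n≤2^n ℓ)
    where
    nn< : n * n < b * b
    nn< = *-mono-< n<b n<b
      where
      n<b : n < b
      n<b = m<m+n n (s≤s z≤n)

  W≤2^ℓ : W ≤ 2 ^ ℓ
  W≤2^ℓ = begin
    (b ^ suc m) ^ suc m         ≡⟨ ^-*-assoc b (suc m) (suc m) ⟩
    b ^ (suc m * suc m)         ≤⟨ ^-monoˡ-≤ (suc m * suc m) (n≤2^n b) ⟩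
    (2 ^ b) ^ (suc m * suc m)   ≡⟨ ^-*-assoc 2 b (suc m * suc m) ⟩
    2 ^ (b * (suc m * suc m))   ≤⟨ ^-monoʳ-≤ 2 (*-monoʳ-≤ b (*-mono-≤ sm≤b sm≤b)) ⟩
    2 ^ ℓ                       ∎
    where open ≤-Reasoning

  suc[2^m]≤2^ℓ : suc (2 ^ m) ≤ 2 ^ ℓ
  suc[2^m]≤2^ℓ = ≤-trans (+-mono-≤ (m^n>0 2 m) (≤-reflexive (≡.sym (+-identityʳ _))))
    (^-monoʳ-≤ 2 (≤-trans sm≤b b≤ℓ))

  n^m<X : n ^ m < X
  n^m<X = ≤-trans (s≤s (^-monoˡ-≤ m (m≤m+n n 2)))
    (≤-trans (m<m*n (b ^ m) b {{m^n≢0 b m}} (≤-trans (s≤s (s≤s z≤n)) (m≤n+m 2 n))) (≤-reflexive (*-comm (b ^ m) b)))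

  quotient-W-X : quotient W X ≡ X ^ m
  quotient-W-X = ≡.trans (quotient-/ W X) (≡.trans (cong (_/ X) (*-comm X (X ^ m))) (m*n/n≡m (X ^ m) X))

  quotient-X^m : ∀ h → quotient (X ^ m * h) (X ^ m) ≡ h
  quotient-X^m h = ≡.trans (quotient-/ (X ^ m * h) (X ^ m)) (≡.trans (cong (_/ (X ^ m)) (*-comm (X ^ m) h)) (m*n/n≡m h (X ^ m)))
    where
    instance
      X^m≢0 : NonZero (X ^ m)
      X^m≢0 = m^n≢0 X m

-- `stepsᵖ` is 23 + 13 x + 3 x²: the sum of 16 + 7 m outside the loop over leaves and 7 + m (6 + 3
-- n²) per leaf, with m and n² replaced by x.
stepsᵖ lengthᵖ cellsᵖ : Polynomial
stepsᵖ  = 23 ∷ 13 ∷ 3 ∷ []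
lengthᵖ = (𝕩 ∔ constant 2) ∙ ((𝕩 ∔ constant 2) ∙ (𝕩 ∔ constant 2))
cellsᵖ  = constant 1 ∔ (constant 1 ∔ 𝕩) ∙ 𝕩

unitᵖ spaceᵖ timeᵖ : ℕ → Polynomial
unitᵖ E  = constant 1 ∔ constant E ∙ (constant 1 ∔ lengthᵖ ∙ constant E)
spaceᵖ E = constant 11 ∙ (cellsᵖ ∙ (constant 1 ∔ lengthᵖ)) ∔ unitᵖ E
timeᵖ E  = stepsᵖ ∙ unitᵖ E

module Bounds {n N : ℕ} (nn≤N : n * n ≤ N) (E : ℕ) (600≤E : 600 ≤ E) (adj : List ℕ) where
  open Parameters n
  open Verification n ℓ 1≤ℓ X W ≡.refl ≡.refl suc[n*n]≤2^ℓ W≤2^ℓ suc[2^m]≤2^ℓ E 600≤E adj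
  open Bounded {11} ℓ 1≤ℓ K
  open Steps 600 E 600≤E
  open Evaluation N

  private
    m : ℕ
    m = n / 2

    n≤N : n ≤ N
    n≤N = ≤-trans (n≤n*n n) nn≤N

    m≤N : m ≤ N
    m≤N = ≤-trans (m/n≤m n 2) n≤N

    ℓ≼ : ℓ ≼ lengthᵖ
    ℓ≼ = b≼ ≼∙ (b≼ ≼∙ b≼)
      where
      b≼ : n + 2 ≼ 𝕩 ∔ constant 2
      b≼ = ≼𝕩 n≤N ≼∔ ≼constant 2

  unit≼ : unit ≼ unitᵖ E
  unit≼ = ≼constant 1 ≼∔ ≼constant E ≼∙ (≼constant 1 ≼∔ ℓ≼ ≼∙ ≼constant E)

  space≼ : space ≼ spaceᵖ E
  space≼ = ≼constant 11 ≼∙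
    ((≼constant 1 ≼∔ (≼constant 1 ≼∔ ≼𝕩 m≤N) ≼∙ ≼𝕩 nn≤N) ≼∙ (≼constant 1 ≼∔ ℓ≼)) ≼∔ unit≼

  space≤ : ∀ {s} → s ≤ space → s ≤ spaceᵖ E at N
  space≤ s≤ = ≤-trans s≤ (≤at space≼)

  mainSteps≤ : mainSteps ≤ 2 ^ m * stepsᵖ at N
  mainSteps≤ = begin
    mainSteps
      ≡⟨ solve 3 (λ m s t → con 9 :+ ((m :* con 4 :+ con 1) :+ (con 2 :+ ((m :* con 3 :+ con 1) :+
             (con 1 :+ ((t :*
               (con 4 :+ ((m :* (con 3 :+ ((s :* con 3 :+ con 1) :+ con 2)) :+ con 1) :+ con 2)) :+ con 1) :+ con 1))))) :=
           (con 16 :+ m :* con 7) :+ t :* (con 7 :+ m :* (con 6 :+ s :* con 3))) ≡.refl m (n * n) (2 ^ m) ⟩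
    (16 + m * 7) + 2 ^ m * (7 + m * (6 + n * n * 3))
      ≤⟨ +-monoˡ-≤ _ (m≤n*m (16 + m * 7) (2 ^ m) {{m^n≢0 2 m}}) ⟩
    2 ^ m * (16 + m * 7) + 2 ^ m * (7 + m * (6 + n * n * 3))
      ≡⟨ *-distribˡ-+ (2 ^ m) (16 + m * 7) _ ⟨
    2 ^ m * (16 + m * 7 + (7 + m * (6 + n * n * 3)))
      ≤⟨ *-monoʳ-≤ (2 ^ m) (+-mono-≤ (+-monoʳ-≤ 16 (*-monoˡ-≤ 7 m≤N))
           (+-monoʳ-≤ 7 (*-mono-≤ m≤N (+-monoʳ-≤ 6 (*-monoˡ-≤ 3 nn≤N))))) ⟩
    2 ^ m * (16 + N * 7 + (7 + N * (6 + N * 3)))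
      ≡⟨ cong (2 ^ m *_) (solve 1 (λ x → con 16 :+ x :* con 7 :+ (con 7 :+ x :* (con 6 :+ x :* con 3)) :=
           con 23 :+ x :* (con 13 :+ x :* (con 3 :+ x :* con 0))) ≡.refl N) ⟩
    2 ^ m * stepsᵖ at N ∎
    where
    open ≤-Reasoning
    open +-*-Solver

  -- Squaring avoids the irrational 2^(n/2) for odd n. With m = n / 2 rounded down, (2^m)² is at
  -- most 2^n.
  time≤ : ∀ {t} → t ≤ mainSteps * unit → t ^ 2 ≤ (timeᵖ E at N) ^ 2 * 2 ^ n
  time≤ {t} t≤ = begin
    t ^ 2                              ≤⟨ ^-monoˡ-≤ 2 t≤′ ⟩
    (2 ^ m * timeᵖ E at N) ^ 2           ≡⟨ solve 2 (λ x y →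
                                              (x :* y) :^ 2 := y :^ 2 :* (x :^ 2)) ≡.refl (2 ^ m) (timeᵖ E at N) ⟩
    (timeᵖ E at N) ^ 2 * (2 ^ m) ^ 2     ≡⟨ cong ((timeᵖ E at N) ^ 2 *_) (^-*-assoc 2 m 2) ⟩
    (timeᵖ E at N) ^ 2 * 2 ^ (m * 2)     ≤⟨ *-monoʳ-≤ ((timeᵖ E at N) ^ 2) (^-monoʳ-≤ 2 (m/n*n≤m n 2)) ⟩
    (timeᵖ E at N) ^ 2 * 2 ^ n           ∎
    where
    open ≤-Reasoning
    open +-*-Solver
    t≤′ : t ≤ 2 ^ m * timeᵖ E at N
    t≤′ = begin
      t                                     ≤⟨ t≤ ⟩
      mainSteps * unit                      ≤⟨ *-mono-≤ mainSteps≤ (≤at (unit≼)) ⟩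
      2 ^ m * stepsᵖ at N * unitᵖ E at N      ≡⟨ *-assoc (2 ^ m) (stepsᵖ at N) (unitᵖ E at N) ⟩
      2 ^ m * (stepsᵖ at N * unitᵖ E at N)    ≡⟨ cong (2 ^ m *_) (at-∙ N stepsᵖ (unitᵖ E)) ⟨
      2 ^ m * timeᵖ E at N                    ∎

module Counting {n : ℕ} (E : ℕ) (600≤E : 600 ≤ E) (G : Graph n) where
  open Parameters n
  private
    adj : List ℕ
    adj = entries (edges G)

    m : ℕ
    m = n / 2

  open Verification n ℓ 1≤ℓ X W ≡.refl ≡.refl suc[n*n]≤2^ℓ W≤2^ℓ suc[2^m]≤2^ℓ E 600≤E adj
  open Bounded {11} ℓ 1≤ℓ K
  open Steps 600 E 600≤E
  open Modular W X

  good-start : Good start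
  good-start = good lengths values
    where
    1≤K : 1 ≤ K
    1≤K = s≤s z≤n
    lengths : ∀ x → length (lookup start x) ≤ K
    lengths zero = 1≤K
    lengths (suc zero) = ≤-trans (≤-reflexive (length-entries (edges G))) (≤-trans (m≤m+n (n * n) _) (n≤1+n _))
    lengths (suc (suc x)) = ≤-trans (≤-reflexive (go x)) z≤n
      where
      go : ∀ {k} (x : Fin k) → length (lookup {A = List ℕ} (Vec.replicate k []) x) ≡ 0
      go zero    = ≡.refl
      go (suc x) = go x
    values : ∀ x → All (_≤ 2 ^ ℓ) (lookup start x)
    values zero = ≤-trans (≤-trans (n≤n*n n) (n≤1+n _)) suc[n*n]≤2^ℓ ∷ []
    values (suc zero) = All.map (λ ≤1 → ≤-trans ≤1 (m^n>0 2 ℓ)) (entries≤1 (edges G))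
    values (suc (suc x)) = go x
      where
      go : ∀ {k} (x : Fin k) → All (_≤ 2 ^ ℓ) (lookup {A = List ℕ} (Vec.replicate k []) x)
      go zero    = []
      go (suc x) = go x

  haf<X : haf A m (pairs 0 m) < X
  haf<X = ≤-trans (s≤s (haf-≤ W X A n (λ i j → read-≤ (entries≤1 (edges G)) _) m (pairs 0 m)
    (≤-trans (≤-reflexive (≡.trans (length-pairs 0 m) (*-comm 2 m))) (m/n*n≤m n 2)))) n^m<X

  n≡2m : n % 2 ≡ 0 → n ≡ 2 * m
  n≡2m eq = ≡.trans (m≡m%n+[m/n]*n n 2) (≡.trans (cong (_+ m * 2) eq) (*-comm m 2))

  haf-count : n % 2 ≡ 0 → haf A m (pairs 0 m) ≡ length (matchings G m (allFin n))
  haf-count even = ≡.trans (cong (haf A m) (≡.trans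
      (pairs-tabulate m 0 toℕ (n≡2m even) (λ _ → ≡.refl)) (≡.sym (map-tabulate id toℕ))))
    (haf-matchings G W X A (read-entries (edges G)) m (allFin n))

  counts : ∀ {T} → T < W → T ≈ ∑ (2 ^ m) (λ z → leaf m 0 z A) →
    HasCardinality (IsPerfectMatching G) (quotient T (quotient W X) * (1 ∸ (n ∸ m * 2)))
  counts {T} T<W T≈ rewrite ≡.sym (m%n≡m∸m/n*n n 2) with n % 2 in parity | m%n<n n 2
  ... | zero | _ = subst (HasCardinality (IsPerfectMatching G)) (≡.sym output≡) (perfect-even G m (n≡2m parity))
    where
    open ≡-Reasoning
    output≡ : quotient T (quotient W X) * 1 ≡ length (matchings G m (allFin n))
    output≡ = begin
      quotient T (quotient W X) * 1                     ≡⟨ *-identityʳ _ ⟩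
      quotient T (quotient W X)                         ≡⟨ cong₂ quotient (∑-leaf-haf X m A T T<W T≈ haf<X) quotient-W-X ⟩
      quotient (X ^ m * haf A m (pairs 0 m)) (X ^ m)    ≡⟨ quotient-X^m _ ⟩
      haf A m (pairs 0 m)                               ≡⟨ haf-count parity ⟩
      length (matchings G m (allFin n))                 ∎
  -- For odd n the pairs miss the last vertex, and `T` concerns the graph without it; the factor 1 ∸
  -- 1 discards that value.
  ... | suc zero | _ = subst (HasCardinality (IsPerfectMatching G)) (≡.sym (*-zeroʳ (quotient T (quotient W X))))
    (perfect-odd G λ k n≡2k → contradiction (≡.trans (≡.sym parity)
      (≡.trans (cong (_% 2) (≡.trans n≡2k (*-comm 2 k))) (m*n%n≡0 k 2))) λ ())
  ... | suc (suc _) | s≤s (s≤s ())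

  output-counts : ∀ σ → Result σ → HasCardinality (IsPerfectMatching G) (output σ)
  output-counts σ (T , output≡ , T<W , T≈) =
    subst (HasCardinality (IsPerfectMatching G)) (≡.sym output≡) (counts {T} T<W T≈)

module _ (E : ℕ) (600≤E : 600 ≤ E) {n : ℕ} (G : Graph n) where
  open Parameters n
  private
    adj : List ℕ
    adj = entries (edges G)

    N : ℕ
    N = size (input G 9)

  open Verification n ℓ 1≤ℓ X W ≡.refl ≡.refl suc[n*n]≤2^ℓ W≤2^ℓ suc[2^m]≤2^ℓ E 600≤E adj
  open Bounded {11} ℓ 1≤ℓ K
  open Steps 600 E 600≤E

  private
    nn≤N : n * n ≤ N
    -- Each of the n² matrix entries occupies at least one bit of the input.
    nn≤N = ≤-trans (≤-reflexive (≡.sym (length-entries (edges G))))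
      (≤-trans (length≤ adj) (≤-trans (m≤m+n _ 0) (m≤n+m _ (bits n + 0))))
      where
      length≤ : ∀ xs → length xs ≤ sum (map bits xs)
      length≤ []       = z≤n
      length≤ (x ∷ xs) = s≤s (≤-trans (length≤ xs) (m≤n+m _ _))

  private
    module B = Bounds {n} {N} nn≤N E 600≤E adj

  -- The execution is a variable here, because Agda would otherwise try to
  -- normalise it.
  conclusion : Run main start mainSteps Result → ∃[ σ ] ∃[ t ] ∃[ s ]
    ⟨ main , input G 9 ⟩⇓ σ ⟨ t , s ⟩
    × HasCardinality (IsPerfectMatching G) (output σ)
    × t ^ 2 ≤ (timeᵖ E at N) ^ 2 * 2 ^ n
    × s ≤ spaceᵖ E at N
  conclusion r =
    Run.σ′ r , Run.t r , Run.s r , Run.exec r ,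
    Counting.output-counts E 600≤E G (Run.σ′ r) (Run.post r) ,
    B.time≤ (Run.t≤ r) , B.space≤ (Run.s≤ r)

  main-correct : ∃[ σ ] ∃[ t ] ∃[ s ]
    ⟨ main , input G 9 ⟩⇓ σ ⟨ t , s ⟩
    × HasCardinality (IsPerfectMatching G) (output σ)
    × t ^ 2 ≤ (timeᵖ E at size (input G 9)) ^ 2 * 2 ^ n
    × s ≤ spaceᵖ E at size (input G 9)
  main-correct = conclusion (run-main (Counting.good-start E 600≤E G))

theorem5p1 : Σ[ k ∈ ℕ ] Σ[ P ∈ Program (2 + k) ] Σ[ p ∈ Polynomial ] Σ[ q ∈ Polynomial ]
    (∀ {n : ℕ} (G : Graph n) →
    let N = size (input G k) in
    ∃[ σ ] ∃[ t ] ∃[ s ]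
    ⟨ P , input G k ⟩⇓ σ ⟨ t , s ⟩
    × HasCardinality (IsPerfectMatching G) (output σ)
    × t ^ 2 ≤ (p at N) ^ 2 * 2 ^ n
    × s ≤ q at N)
theorem5p1 = 9 , main , timeᵖ 600 , spaceᵖ 600 , main-correct 600 600≤600
  where
  600≤600 : 600 ≤ 600
  600≤600 = ≤-refl
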